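{- Let $F$ be a field containing $\mathbb{F}_q$, equipped with a discrete non-archimedean valuation $\nu:F\to\mathbb{Z}\cup\{\infty\}$ with $\nu(F^*)=\mathbb{Z}$. Let $f,g\in F\{\tau\}$ be normalized polynomials. Let $d$ and $\ell$ denote their normalized GCD and LCM in $F\{\tau\}$, respectively. Then, for all $z\in\mathbb{R}$, $$\mathbf{V}^\nu_d(z)+\mathbf{V}^\nu_\ell(z)\leqslant\mathbf{V}^\nu_f(z)+\mathbf{V}^\nu_g(z).$$
   Context: $F\{\tau\}$ is the ring of twisted polynomials $\sum_i f_i\tau^i$ ($f_i\in F$) with $\tau c=c^q\tau$ for $c\in F$. A polynomial $f=\sum_{i=0}^d f_i\tau^i\in F\{\tau\}$ is normalized if its constant coefficient $f_0$ equals $1$. Every left ideal of $F\{\tau\}$ is principal. For $f,g\in F\{\tau\}$ with nonzero constant coefficients, their (right) GCD is the unique normalized generator of the left ideal $F\{\tau\}\cdot f+F\{\tau\}\cdot g$, and their (right) LCM is the unique normalized generator of the left ideal $F\{\tau\}\cdot f\cap F\{\tau\}\cdot g$. For $f=\sum_{i=0}^d f_i\tau^i\in F\{\tau\}$ with $f_0\ne0$ and $z\in\mathbb{R}$, set $\mathbf{V}^\nu_f(z)=\min\{\nu(f_i)+q^i z:0\leqslant i\leqslant d\}$. -}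

module Defs where

open import Level using (Level; _⊔_; suc)
open import Algebra.Bundles using (CommutativeRing)
open import Algebra.Construct.Add.Identity using (liftOp)
open import Algebra.Morphism.Structures using (IsRingMonomorphism)
import Algebra.Properties.Semiring.Exp as Exp
open import Data.Fin.Base using (Fin; toℕ)
open import Data.Integer.Base as ℤ using (ℤ; +_)
open import Data.List.Base as List using (List; []; _∷_; length; lookup; foldr; tabulate)
import Data.Maybe.Base as Maybe
open import Data.Nat.Base as ℕ using (ℕ; zero)
import Data.Nat.Properties as ℕₚ
open import Data.Nat.Primality using (Prime)
open import Data.Product.Base using (∃-syntax; _×_; _,_)
open import Data.Rational.Base as ℚ using (ℚ; 0ℚ; 1ℚ; _/_; 1/_)
import Data.Rational.Properties as ℚₚ
open import Data.Rational.Solver using (module +-*-Solver)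
open import Data.Sum.Base using (_⊎_; inj₁; inj₂)
open import Function.Bundles using (Inverse; _⇔_)
open import Relation.Binary.Construct.Add.Supremum.NonStrict using (_≤⁺_)
open import Relation.Binary.PropositionalEquality as ≡ using (_≡_; refl; sym; cong; subst)
open import Relation.Nullary.Construct.Add.Supremum using (_⁺; ⊤⁺; [_])
open import Relation.Nullary.Negation.Core using (¬_)
open import Relation.Unary using (Pred; _∈_; _∩_; _≐_)

------------------------------------------------------------------------
-- Real numbers, as Cauchy sequences of rationals. Two sequences represent
-- the same real number when each is _≤ℝ_ the other.

IsCauchy : (ℕ → ℚ) → Set
IsCauchy x = ∀ ε → 0ℚ ℚ.< ε →
  ∃[ N ] (∀ m n → N ℕ.≤ m → N ℕ.≤ n → ℚ.∣ x m ℚ.- x n ∣ ℚ.< ε)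

record ℝ : Set where
  constructor mkℝ
  field
    seq    : ℕ → ℚ
    cauchy : IsCauchy seq

open ℝ public

infix 4 _≤ℝ_

-- The slack ε is needed: pointwise comparison of representatives is not
-- invariant under equality of real numbers.
_≤ℝ_ : ℝ → ℝ → Set
x ≤ℝ y = ∀ ε → 0ℚ ℚ.< ε → ∃[ N ] (∀ n → N ℕ.≤ n → seq x n ℚ.≤ seq y n ℚ.+ ε)

private
  ∣-∣<⇒< : ∀ a b {ε} → ℚ.∣ a ℚ.- b ∣ ℚ.< ε → a ℚ.< b ℚ.+ ε
  ∣-∣<⇒< a b {ε} h = begin-strict
    a                    ≡⟨ solve 2 (λ x y → x := y :+ (x :- y)) refl a b ⟩
    b ℚ.+ (a ℚ.- b)      ≤⟨ ℚₚ.+-monoʳ-≤ b (p≤∣p∣ (a ℚ.- b)) ⟩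
    b ℚ.+ ℚ.∣ a ℚ.- b ∣  <⟨ ℚₚ.+-monoʳ-< b h ⟩
    b ℚ.+ ε              ∎
    where
    open ℚₚ.≤-Reasoning
    open +-*-Solver
    p≤∣p∣ : ∀ p → p ℚ.≤ ℚ.∣ p ∣
    p≤∣p∣ p with ℚₚ.≤-total 0ℚ p
    ... | inj₁ 0≤p = ℚₚ.≤-reflexive (sym (ℚₚ.0≤p⇒∣p∣≡p 0≤p))
    ... | inj₂ p≤0 = ℚₚ.≤-trans p≤0 (ℚₚ.0≤∣p∣ p)

  <⇒∣-∣< : ∀ {a b ε} → a ℚ.< b ℚ.+ ε → b ℚ.< a ℚ.+ ε → ℚ.∣ a ℚ.- b ∣ ℚ.< ε
  <⇒∣-∣< {a} {b} {ε} a<b+ε b<a+ε with ℚₚ.∣p∣≡p∨∣p∣≡-p (a ℚ.- b)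
  ... | inj₁ eq = begin-strict
    ℚ.∣ a ℚ.- b ∣      ≡⟨ eq ⟩
    a ℚ.- b            <⟨ ℚₚ.+-monoˡ-< (ℚ.- b) a<b+ε ⟩
    (b ℚ.+ ε) ℚ.- b    ≡⟨ solve 2 (λ y e → (y :+ e) :- y := e) refl b ε ⟩
    ε                  ∎
    where
    open ℚₚ.≤-Reasoning
    open +-*-Solver
  ... | inj₂ eq = begin-strict
    ℚ.∣ a ℚ.- b ∣      ≡⟨ eq ⟩
    ℚ.- (a ℚ.- b)      ≡⟨ solve 2 (λ x y → :- (x :- y) := y :- x) refl a b ⟩
    b ℚ.- a            <⟨ ℚₚ.+-monoˡ-< (ℚ.- a) b<a+ε ⟩
    (a ℚ.+ ε) ℚ.- a    ≡⟨ solve 2 (λ x e → (x :+ e) :- x := e) refl a ε ⟩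
    ε                  ∎
    where
    open ℚₚ.≤-Reasoning
    open +-*-Solver

  ∣-∣-sym : ∀ a b → ℚ.∣ a ℚ.- b ∣ ≡ ℚ.∣ b ℚ.- a ∣
  ∣-∣-sym a b = ≡.trans (sym (ℚₚ.∣-p∣≡∣p∣ (a ℚ.- b)))
    (cong ℚ.∣_∣ (solve 2 (λ x y → :- (x :- y) := y :- x) refl a b))
    where
    open +-*-Solver

  ∣-∣<⇒> : ∀ a b {ε} → ℚ.∣ a ℚ.- b ∣ ℚ.< ε → b ℚ.< a ℚ.+ ε
  ∣-∣<⇒> a b h = ∣-∣<⇒< b a (subst (ℚ._< _) (∣-∣-sym a b) h)

  ⊓-< : ∀ {a b c d ε} → a ℚ.< c ℚ.+ ε → b ℚ.< d ℚ.+ ε →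
        a ℚ.⊓ b ℚ.< (c ℚ.⊓ d) ℚ.+ ε
  ⊓-< {a} {b} {c} {d} h₁ h₂ with ℚₚ.⊓-sel c d
  ... | inj₁ eq rewrite eq = ℚₚ.≤-<-trans (ℚₚ.p⊓q≤p a b) h₁
  ... | inj₂ eq rewrite eq = ℚₚ.≤-<-trans (ℚₚ.p⊓q≤q a b) h₂

  +-< : ∀ {a b c d δ} → a ℚ.< c ℚ.+ δ → b ℚ.< d ℚ.+ δ →
        a ℚ.+ b ℚ.< (c ℚ.+ d) ℚ.+ (δ ℚ.+ δ)
  +-< {a} {b} {c} {d} {δ} h₁ h₂ = begin-strict
    a ℚ.+ b                          <⟨ ℚₚ.+-mono-< h₁ h₂ ⟩
    (c ℚ.+ δ) ℚ.+ (d ℚ.+ δ)          ≡⟨ solve 3 (λ x y e → (x :+ e) :+ (y :+ e) := (x :+ y) :+ (e :+ e)) refl c d δ ⟩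
    (c ℚ.+ d) ℚ.+ (δ ℚ.+ δ)          ∎
    where
    open ℚₚ.≤-Reasoning
    open +-*-Solver

  ½*-pos : ∀ {ε} → 0ℚ ℚ.< ε → 0ℚ ℚ.< ℚ.½ ℚ.* ε
  ½*-pos {ε} 0<ε = subst (ℚ._< ℚ.½ ℚ.* ε) (ℚₚ.*-zeroʳ ℚ.½) (ℚₚ.*-monoʳ-<-pos ℚ.½ 0<ε)

  ½+½ : ∀ ε → ℚ.½ ℚ.* ε ℚ.+ ℚ.½ ℚ.* ε ≡ ε
  ½+½ ε = ≡.trans (sym (ℚₚ.*-distribʳ-+ ε ℚ.½ ℚ.½)) (ℚₚ.*-identityˡ ε)

  const-cauchy : ∀ r → IsCauchy (λ _ → r)
  const-cauchy r ε 0<ε = 0 , λ _ _ _ _ →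
    subst (ℚ._< ε) (sym (cong ℚ.∣_∣ (ℚₚ.+-inverseʳ r))) 0<ε

  +-cauchy : ∀ x y → IsCauchy x → IsCauchy y → IsCauchy (λ n → x n ℚ.+ y n)
  +-cauchy x y cx cy ε 0<ε with cx (ℚ.½ ℚ.* ε) (½*-pos 0<ε) | cy (ℚ.½ ℚ.* ε) (½*-pos 0<ε)
  ... | M , hx | N , hy = M ℕ.⊔ N , λ m n p q →
    let X = hx m n (ℕₚ.m⊔n≤o⇒m≤o M N p) (ℕₚ.m⊔n≤o⇒m≤o M N q)
        Y = hy m n (ℕₚ.m⊔n≤o⇒n≤o M N p) (ℕₚ.m⊔n≤o⇒n≤o M N q)
    in subst (ℚ.∣ (x m ℚ.+ y m) ℚ.- (x n ℚ.+ y n) ∣ ℚ.<_) (½+½ ε)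
         (<⇒∣-∣< {x m ℚ.+ y m} {x n ℚ.+ y n}
           (+-< {c = x n} {y n} {δ = ℚ.½ ℚ.* ε} (∣-∣<⇒< (x m) (x n) X) (∣-∣<⇒< (y m) (y n) Y))
           (+-< {c = x m} {y m} {δ = ℚ.½ ℚ.* ε} (∣-∣<⇒> (x m) (x n) X) (∣-∣<⇒> (y m) (y n) Y)))

  ⊓-cauchy : ∀ x y → IsCauchy x → IsCauchy y → IsCauchy (λ n → x n ℚ.⊓ y n)
  ⊓-cauchy x y cx cy ε 0<ε with cx ε 0<ε | cy ε 0<ε
  ... | M , hx | N , hy = M ℕ.⊔ N , λ m n p q →
    let X = hx m n (ℕₚ.m⊔n≤o⇒m≤o M N p) (ℕₚ.m⊔n≤o⇒m≤o M N q)
        Y = hy m n (ℕₚ.m⊔n≤o⇒n≤o M N p) (ℕₚ.m⊔n≤o⇒n≤o M N q)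
    in <⇒∣-∣< {x m ℚ.⊓ y m} {x n ℚ.⊓ y n}
         (⊓-< {c = x n} {y n} (∣-∣<⇒< (x m) (x n) X) (∣-∣<⇒< (y m) (y n) Y))
         (⊓-< {c = x m} {y m} (∣-∣<⇒> (x m) (x n) X) (∣-∣<⇒> (y m) (y n) Y))

  *-cauchy : ∀ c x → IsCauchy x → IsCauchy (λ n → c ℚ.* x n)
  *-cauchy c x cx ε 0<ε = let N , h = cx (1/ s ℚ.* ε) 0<δ in
    N , λ m n p q → bound (x m) (x n) (h m n p q)
    where
    s = 1ℚ ℚ.+ ℚ.∣ c ∣
    instance
      s-pos : ℚ.Positive s
      s-pos = ℚ.positive (ℚₚ.+-mono-<-≤ (ℚₚ.positive⁻¹ 1ℚ) (ℚₚ.0≤∣p∣ c))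
      s≢0 : ℚ.NonZero s
      s≢0 = ℚₚ.pos⇒nonZero s
      1/s-pos : ℚ.Positive (1/ s)
      1/s-pos = ℚₚ.1/pos⇒pos s
    0<δ : 0ℚ ℚ.< 1/ s ℚ.* ε
    0<δ = subst (ℚ._< 1/ s ℚ.* ε) (ℚₚ.*-zeroʳ (1/ s)) (ℚₚ.*-monoʳ-<-pos (1/ s) 0<ε)
    bound : ∀ a b → ℚ.∣ a ℚ.- b ∣ ℚ.< 1/ s ℚ.* ε → ℚ.∣ c ℚ.* a ℚ.- c ℚ.* b ∣ ℚ.< ε
    bound a b a-b<δ = begin-strict
      ℚ.∣ c ℚ.* a ℚ.- c ℚ.* b ∣        ≡⟨ cong ℚ.∣_∣ (solve 3 (λ k x y → k :* x :- k :* y := k :* (x :- y)) refl c a b) ⟩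
      ℚ.∣ c ℚ.* (a ℚ.- b) ∣            ≡⟨ ℚₚ.∣p*q∣≡∣p∣*∣q∣ c (a ℚ.- b) ⟩
      ℚ.∣ c ∣ ℚ.* ∣a-b∣                ≡⟨ ℚₚ.+-identityˡ _ ⟨
      0ℚ ℚ.+ ℚ.∣ c ∣ ℚ.* ∣a-b∣         ≤⟨ ℚₚ.+-monoˡ-≤ _ (ℚₚ.0≤∣p∣ (a ℚ.- b)) ⟩
      ∣a-b∣ ℚ.+ ℚ.∣ c ∣ ℚ.* ∣a-b∣      ≡⟨ solve 2 (λ k d → d :+ k :* d := (con 1ℚ :+ k) :* d) refl ℚ.∣ c ∣ ∣a-b∣ ⟩
      s ℚ.* ∣a-b∣                      <⟨ ℚₚ.*-monoʳ-<-pos s a-b<δ ⟩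
      s ℚ.* (1/ s ℚ.* ε)               ≡⟨ ℚₚ.*-assoc s (1/ s) ε ⟨
      (s ℚ.* 1/ s) ℚ.* ε               ≡⟨ cong (ℚ._* ε) (ℚₚ.*-inverseʳ s) ⟩
      1ℚ ℚ.* ε                         ≡⟨ ℚₚ.*-identityˡ ε ⟩
      ε                                ∎
      where
      open ℚₚ.≤-Reasoning
      open +-*-Solver
      ∣a-b∣ = ℚ.∣ a ℚ.- b ∣

infixl 6 _+ℝ_
infixl 7 _⊓ℝ_
infixr 7 _·_

fromℤ : ℤ → ℝ
fromℤ k = mkℝ (λ _ → k / 1) (const-cauchy (k / 1))

_+ℝ_ : ℝ → ℝ → ℝ
x +ℝ y = mkℝ (λ n → seq x n ℚ.+ seq y n) (+-cauchy (seq x) (seq y) (cauchy x) (cauchy y))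

_⊓ℝ_ : ℝ → ℝ → ℝ
x ⊓ℝ y = mkℝ (λ n → seq x n ℚ.⊓ seq y n) (⊓-cauchy (seq x) (seq y) (cauchy x) (cauchy y))

_·_ : ℕ → ℝ → ℝ
k · x = mkℝ (λ n → (+ k / 1) ℚ.* seq x n) (*-cauchy (+ k / 1) (seq x) (cauchy x))

------------------------------------------------------------------------
-- ℤ ∪ {∞} and ℝ ∪ {∞}: ∞ is ⊤⁺; it absorbs in sums and is neutral for min.

infix  4 _≤∞_ _≤ℝ∞_
infixl 6 _+∞_ _+ℝ∞_
infixl 7 _⊓∞_ _⊓ℝ∞_

_≤∞_ : ℤ ⁺ → ℤ ⁺ → Set
_≤∞_ = _≤⁺_ ℤ._≤_

_+∞_ _⊓∞_ : ℤ ⁺ → ℤ ⁺ → ℤ ⁺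
_+∞_ = Maybe.zipWith ℤ._+_
_⊓∞_ = liftOp ℤ._⊓_

_≤ℝ∞_ : ℝ ⁺ → ℝ ⁺ → Set
_≤ℝ∞_ = _≤⁺_ _≤ℝ_

_+ℝ∞_ _⊓ℝ∞_ : ℝ ⁺ → ℝ ⁺ → ℝ ⁺
_+ℝ∞_ = Maybe.zipWith _+ℝ_
_⊓ℝ∞_ = liftOp _⊓ℝ_

fromℤ∞ : ℤ ⁺ → ℝ ⁺
fromℤ∞ = Maybe.map fromℤ

------------------------------------------------------------------------

record Field c ℓ : Set (suc (c ⊔ ℓ)) where
  field
    commutativeRing : CommutativeRing c ℓ

  open CommutativeRing commutativeRing public

  field
    1≉0     : ¬ (1# ≈ 0#)
    inverse : ∀ x → ¬ (x ≈ 0#) → ∃[ y ] (x * y ≈ 1#)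

IsPrimePower : ℕ → Set
IsPrimePower q = ∃[ p ] ∃[ k ] (Prime p × 1 ℕ.≤ k × q ≡ p ℕ.^ k)

-- An embedding of a field with q elements (that is, of 𝔽_q) into F.
record Contains𝔽 {c ℓ} (q : ℕ) (F : Field c ℓ) a b : Set (c ⊔ ℓ ⊔ suc (a ⊔ b)) where
  field
    isPrimePower : IsPrimePower q
    𝔽            : Field a b
    cardinality  : Inverse (Field.setoid 𝔽) (≡.setoid (Fin q))
    ι            : Field.Carrier 𝔽 → Field.Carrier F
    ι-isMono     : IsRingMonomorphism (Field.rawRing 𝔽) (Field.rawRing F) ι

record DiscreteValuation {c ℓ} (F : Field c ℓ) : Set (c ⊔ ℓ) where
  open Field F
  field
    ν            : Carrier → ℤ ⁺
    ν-cong       : ∀ {x y} → x ≈ y → ν x ≡ ν y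
    ν≡∞⇔≈0       : ∀ x → (ν x ≡ ⊤⁺) ⇔ (x ≈ 0#)
    ν-*          : ∀ x y → ν (x * y) ≡ ν x +∞ ν y
    ν-+          : ∀ x y → ν x ⊓∞ ν y ≤∞ ν (x + y)
    -- With ν≡∞⇔≈0 this says ν(F*) = ℤ.
    ν-surjective : ∀ k → ∃[ x ] (ν x ≡ [ k ])

------------------------------------------------------------------------
-- F{τ}, with τ c = c^q τ

module Twisted {c ℓ} (q : ℕ) (F : Field c ℓ) where

  open Field F
  open Exp semiring using (_^_)

  infix  4 _≈ₚ_
  infixl 6 _+ₚ_ _+ᴵ_
  infixl 7 _*ₚ_

  -- f₀ ∷ f₁ ∷ … ∷ f_d ∷ [] stands for Σ fᵢ τⁱ; trailing zeros are allowed,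
  -- so equality is _≈ₚ_, not equality of lists.
  Poly : Set c
  Poly = List Carrier

  coeff : Poly → ℕ → Carrier
  coeff []      _         = 0#
  coeff (a ∷ f) zero      = a
  coeff (a ∷ f) (ℕ.suc i) = coeff f i

  _≈ₚ_ : Poly → Poly → Set ℓ
  f ≈ₚ g = ∀ i → coeff f i ≈ coeff g i

  _+ₚ_ : Poly → Poly → Poly
  []      +ₚ g       = g
  (a ∷ f) +ₚ []      = a ∷ f
  (a ∷ f) +ₚ (b ∷ g) = (a + b) ∷ (f +ₚ g)

  -- τ (Σ gⱼ τʲ) = Σ gⱼ^q τʲ⁺¹
  τ*_ : Poly → Poly
  τ* g = 0# ∷ List.map (_^ q) g

  -- (a + f τ) g = a g + f (τ g)
  _*ₚ_ : Poly → Poly → Poly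
  []      *ₚ g = []
  (a ∷ f) *ₚ g = List.map (a *_) g +ₚ f *ₚ (τ* g)

  IsNormalized : Poly → Set ℓ
  IsNormalized f = coeff f 0 ≈ 1#

  -- F{τ}·f
  ⟨_⟩ : Poly → Pred Poly (c ⊔ ℓ)
  ⟨ f ⟩ h = ∃[ a ] (h ≈ₚ a *ₚ f)

  _+ᴵ_ : Pred Poly (c ⊔ ℓ) → Pred Poly (c ⊔ ℓ) → Pred Poly (c ⊔ ℓ)
  (I +ᴵ J) h = ∃[ u ] ∃[ v ] (u ∈ I × v ∈ J × h ≈ₚ u +ₚ v)

  IsNormalizedGCD : Poly → Poly → Poly → Set (c ⊔ ℓ)
  IsNormalizedGCD f g d = IsNormalized d × ⟨ d ⟩ ≐ ⟨ f ⟩ +ᴵ ⟨ g ⟩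

  IsNormalizedLCM : Poly → Poly → Poly → Set (c ⊔ ℓ)
  IsNormalizedLCM f g l = IsNormalized l × ⟨ l ⟩ ≐ ⟨ f ⟩ ∩ ⟨ g ⟩

  module _ (v : DiscreteValuation F) where
    open DiscreteValuation v

    -- V f z = min { ν(fᵢ) + qⁱ z : 0 ≤ i ≤ d }. Zero coefficients contribute ∞,
    -- so trailing zeros do not matter, and V f z is finite as soon as f₀ ≉ 0.
    V : Poly → ℝ → ℝ ⁺
    V f z = foldr _⊓ℝ∞_ ⊤⁺
      (tabulate {n = length f} λ i → fromℤ∞ (ν (lookup f i)) +ℝ∞ [ (q ℕ.^ toℕ i) · z ])

-- The real number z enters V only through the terms of a Cauchy sequence representing it, so it may
-- be taken rational. Writing f = a d and g = b d, one has α a + β b = 1 and ℓ = r a d = s b d. By the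
-- Gauss lemma V_{xy} = V_x ∘ V_y, so with w = V_d(z) and y = V_a(w) the claim becomes
-- V_r(y) − y ≤ V_b(w) − w. For w large it reads 0 ≤ 0, and it propagates to the left through the
-- breakpoints of V_b as soon as the slope of V_r to the left of y is at least that of V_b to the left
-- of w. If instead the slopes were q^j < q^k, then Weierstrass division by r would approximate
-- α, τα, …, τ^jα modulo F{τ}r arbitrarily well by j + 1 polynomials of degree < j. A linear relation
-- between these gives x ≠ 0 of degree ≤ j < k such that x = x(αa + βb) is congruent modulo F{τ}b to
-- an element of strictly larger norm, which the Gauss lemma forbids.

module Submission where

import Algebra.Properties.AbelianGroup as AbelianGroupProperties
import Algebra.Properties.CommutativeMonoid.Sum as Sum
import Algebra.Properties.CommutativeSemigroup as CommutativeSemigroupProperties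
import Algebra.Properties.CommutativeSemiring.Binomial as Binomial
import Algebra.Properties.CommutativeSemiring.Exp as CommutativeExp
import Algebra.Properties.Group as GroupProperties
import Algebra.Properties.Ring as RingProperties
import Algebra.Properties.Semiring.Exp as Exp
import Algebra.Properties.Semiring.Mult as Mult
open import Algebra.Bundles using (CommutativeRing)
open import Algebra.Morphism.Structures using (IsRingMonomorphism)
open import Data.Fin.Base as Fin using (Fin; toℕ; inject₁; fromℕ)
open import Data.Fin.Permutation using (Permutation′; permutation; _⟨$⟩ʳ_)
import Data.Fin.Properties as Finₚ
open import Data.Integer.Base as ℤ using (ℤ; +_)
import Data.Integer.Properties as ℤₚ
open import Data.List.Base as List using ([]; _∷_; length; lookup; tabulate; foldr)
open import Data.Maybe.Base using (just; nothing)
open import Data.Maybe.Properties using (just-injective)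
open import Data.Nat.Base as ℕ using (ℕ; zero; suc)
open import Data.Nat.Combinatorics using (_C_; nCk≡n!/k![n-k]!; k![n∸k]!∣n!; nCn≡1)
open import Data.Nat.Divisibility as Div using (_∣_; divides)
open import Data.Nat.DivMod using (m/n*n≡m)
open import Data.Nat.Primality using (Prime; euclidsLemma; prime⇒nonTrivial)
import Data.Nat.Properties as ℕₚ
open import Data.Product.Base using (∃-syntax; _×_; _,_; proj₁; proj₂)
open import Data.Rational.Base as ℚ using (ℚ; 0ℚ; 1ℚ; _/_; 1/_; toℚᵘ)
import Data.Rational.Properties as ℚₚ
open import Data.Rational.Solver using (module +-*-Solver)
import Data.Rational.Unnormalised.Base as ℚᵘ
import Data.Rational.Unnormalised.Properties as ℚᵘₚ
open import Data.Sum.Base using (_⊎_; inj₁; inj₂)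
open import Function.Base using (_∘_)
open import Function.Bundles using (Inverse; Equivalence)
open import Level using (_⊔_; Lift; lift; lower)
open import Relation.Binary.Construct.Add.Supremum.NonStrict using ([_])
open import Relation.Binary.Definitions using (tri<; tri≈; tri>)
open import Relation.Binary.PropositionalEquality as ≡ using (_≡_)
import Relation.Binary.Reasoning.Setoid as SetoidReasoning
open import Relation.Nullary using (¬_; yes; no; Dec; contradiction)
open import Relation.Nullary.Construct.Add.Supremum using (_⁺; ⊤⁺; [_])
open import Relation.Nullary.Decidable using (map′)

open import Defs

open +-*-Solver using (solve; con; _:+_; _:*_; _:-_; :-_; _:=_)


-- V_f is concave and piecewise linear with slopes qⁱ, and its slope just to the left of `w` is q^K
-- for the last index K at which the minimum is attained. So slopes are compared through last
-- minimising indices. These add up in a product, thanks to a gap δ that separates all later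
-- coefficients from the minimum. Propagation to the left rests on all slopes being at least 1: when
-- `w` moves left, `y` = V_a(w) moves at least as far, so V_r(y) - y drops by at least as much as
-- V_b(w) - w. `F` may fail to be complete, so Weierstrass division cannot be carried to its limit.
-- A gain of 1 over the norm of `x` already gives the contradiction, and finitely many rounds of
-- division, each gaining δ, provide it. The degree of `x` decides the end: `x` has no coefficient
-- from index k on, and that is where every nonzero multiple of `b` has its last minimum.

-- Additivity of the q-th power map

prime∤! : ∀ {p} → Prime p → ∀ m → m ℕ.< p → ¬ (p ∣ m ℕ.!)
prime∤! {p} pr zero    _   p∣1 = ℕₚ.<⇒≱ (ℕ.nonTrivial⇒n>1 p) (Div.∣⇒≤ p∣1)
  where instance _ = prime⇒nonTrivial pr
prime∤! pr (suc m) m<p p∣m! with euclidsLemma (suc m) (m ℕ.!) pr p∣m!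
... | inj₁ p∣1+m = ℕₚ.<⇒≱ m<p (Div.∣⇒≤ p∣1+m)
... | inj₂ p∣m!  = prime∤! pr m (ℕₚ.<-trans (ℕₚ.n<1+n m) m<p) p∣m!

prime∣C : ∀ {p} → Prime p → ∀ k → 0 ℕ.< k → k ℕ.< p → p ∣ (p C k)
prime∣C {suc p} pr k 0<k k<p with euclidsLemma (suc p C k) _ pr p∣C*d
  where
  k≤p = ℕₚ.<⇒≤ k<p
  instance _ = k ℕₚ.!* (suc p ℕ.∸ k) !≢0
  p∣C*d : suc p ∣ (suc p C k) ℕ.* (k ℕ.! ℕ.* (suc p ℕ.∸ k) ℕ.!)
  p∣C*d = ≡.subst (suc p ∣_)
    (≡.sym (≡.trans (≡.cong (ℕ._* (k ℕ.! ℕ.* (suc p ℕ.∸ k) ℕ.!)) (nCk≡n!/k![n-k]! k≤p))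
                    (m/n*n≡m (k![n∸k]!∣n! k≤p))))
    (Div.m∣m*n (p ℕ.!))
... | inj₁ p∣C = p∣C
... | inj₂ p∣d with euclidsLemma (k ℕ.!) _ pr p∣d
...   | inj₁ p∣k!  = contradiction p∣k! (prime∤! pr k k<p)
...   | inj₂ p∣k'! = contradiction p∣k'! (prime∤! pr (suc p ℕ.∸ k) (ℕₚ.∸-monoʳ-< 0<k (ℕₚ.<⇒≤ k<p)))

module CharacteristicP {c ℓ} (R : CommutativeRing c ℓ) where
  open CommutativeRing R
  open Exp semiring using (_^_; ^-congˡ; ^-assocʳ)
  open Mult semiring using (×-congʳ; ×-congˡ; ×-assocˡ; ×-assoc-*) renaming (_×_ to _·1_)
  open Sum +-commutativeMonoid using (sum; sum-cong-≋; sum-replicate-zero; sum-init-last)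
  open SetoidReasoning setoid

  module _ {p} (pr : Prime p) (p≈0 : p ·1 1# ≈ 0#) where

    multiple≈0 : ∀ {m} x → p ∣ m → m ·1 x ≈ 0#
    multiple≈0 x (divides k ≡.refl) = begin
      (k ℕ.* p) ·1 x       ≈⟨ ×-congˡ (ℕₚ.*-comm k p) ⟩
      (p ℕ.* k) ·1 x       ≈⟨ ×-assocˡ x p k ⟨
      p ·1 (k ·1 x)        ≈⟨ ×-congʳ p (*-identityˡ _) ⟨
      p ·1 (1# * k ·1 x)   ≈⟨ ×-assoc-* p 1# _ ⟨
      (p ·1 1#) * k ·1 x   ≈⟨ *-congʳ p≈0 ⟩
      0# * k ·1 x          ≈⟨ zeroˡ _ ⟩
      0#                   ∎

    ^p-distrib-+ : ∀ x y → (x + y) ^ p ≈ x ^ p + y ^ p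
    ^p-distrib-+ x y = trans (Binomial.theorem commutativeSemiring p x y) (expand pr ≡.refl)
      where
      term : ∀ n → Fin (suc n) → Carrier
      term = Binomial.binomialTerm commutativeSemiring x y
      -- The exponent is abstracted as `m` so that it can be matched as a successor; the equation
      -- with `p` keeps `multiple≈0` applicable.
      expand : ∀ {m} → Prime m → m ≡ p → sum (term m) ≈ x ^ m + y ^ m
      expand {suc m} pr ≡.refl = begin
        term (suc m) Fin.zero + sum (λ i → term (suc m) (Fin.suc i))
          ≈⟨ +-cong first (sum-init-last (λ i → term (suc m) (Fin.suc i))) ⟩
        y ^ suc m + (sum (λ i → term (suc m) (Fin.suc (inject₁ i))) + term (suc m) (Fin.suc (fromℕ m)))
          ≈⟨ +-congˡ (+-cong (trans (sum-cong-≋ middle) (sum-replicate-zero m)) last) ⟩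
        y ^ suc m + (0# + x ^ suc m)
          ≈⟨ +-congˡ (+-identityˡ _) ⟩
        y ^ suc m + x ^ suc m
          ≈⟨ +-comm _ _ ⟩
        x ^ suc m + y ^ suc m ∎
        where
        first : term (suc m) Fin.zero ≈ y ^ suc m
        first = trans (+-identityʳ _) (*-identityˡ _)
        last : term (suc m) (Fin.suc (fromℕ m)) ≈ x ^ suc m
        last rewrite Finₚ.toℕ-fromℕ m | nCn≡1 (suc m) | ℕₚ.n∸n≡0 m =
          trans (+-identityʳ _) (*-identityʳ _)
        middle : ∀ i → term (suc m) (Fin.suc (inject₁ i)) ≈ 0#
        middle i = multiple≈0 _ (prime∣C pr _ (ℕ.s≤s ℕ.z≤n)
          (ℕ.s≤s (≡.subst (ℕ._< m) (≡.sym (Finₚ.toℕ-inject₁ i)) (Finₚ.toℕ<n i))))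

    ^pᵏ-distrib-+ : ∀ k x y → (x + y) ^ (p ℕ.^ k) ≈ x ^ (p ℕ.^ k) + y ^ (p ℕ.^ k)
    ^pᵏ-distrib-+ zero    x y = trans (*-identityʳ _) (sym (+-cong (*-identityʳ _) (*-identityʳ _)))
    ^pᵏ-distrib-+ (suc k) x y = begin
      (x + y) ^ (p ℕ.* p ℕ.^ k)                  ≈⟨ ^-assocʳ _ p _ ⟨
      ((x + y) ^ p) ^ (p ℕ.^ k)                  ≈⟨ ^-congˡ (p ℕ.^ k) (^p-distrib-+ x y) ⟩
      (x ^ p + y ^ p) ^ (p ℕ.^ k)                ≈⟨ ^pᵏ-distrib-+ k _ _ ⟩
      (x ^ p) ^ (p ℕ.^ k) + (y ^ p) ^ (p ℕ.^ k)  ≈⟨ +-cong (^-assocʳ _ p _) (^-assocʳ _ p _) ⟩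
      x ^ (p ℕ.* p ℕ.^ k) + y ^ (p ℕ.* p ℕ.^ k)  ∎

module FiniteField {a b q} (K : Field a b)
  (card : Inverse (Field.setoid K) (≡.setoid (Fin q))) where
  open Field K
  open Inverse card using (to; from; to-cong; inverseʳ; strictlyInverseʳ; strictlyInverseˡ)
  open Mult semiring using (×1-homo-*) renaming (_×_ to _·1_)
  open Sum +-commutativeMonoid
    using (sum; sum-cong-≋; ∑-distrib-+; sum-permute; sum-replicate)
  open GroupProperties +-group using (∙-cancelʳ)
  open SetoidReasoning setoid

  _≟_ : ∀ x y → Dec (x ≈ y)
  x ≟ y = map′ (λ eq → trans (sym (strictlyInverseʳ x)) (inverseʳ eq)) to-cong
    (to x Finₚ.≟ to y)

  translation : Permutation′ q
  translation = permutation (λ i → to (1# + from i)) (λ i → to (- 1# + from i))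
    (λ i → ≡.trans (to-cong (cancel (-‿inverseʳ 1#) i)) (strictlyInverseˡ i))
    (λ i → ≡.trans (to-cong (cancel (-‿inverseˡ 1#) i)) (strictlyInverseˡ i))
    where
    cancel : ∀ {x y} → x + y ≈ 0# → ∀ i → x + from (to (y + from i)) ≈ from i
    cancel {x} {y} x+y≈0 i = begin
      x + from (to (y + from i))  ≈⟨ +-congˡ (strictlyInverseʳ _) ⟩
      x + (y + from i)            ≈⟨ +-assoc _ _ _ ⟨
      (x + y) + from i            ≈⟨ +-congʳ x+y≈0 ⟩
      0# + from i                 ≈⟨ +-identityˡ _ ⟩
      from i                      ∎

  -- Translation by 1 permutes the field, so it preserves the sum of all elements.
  q≈0 : q ·1 1# ≈ 0#
  q≈0 = ∙-cancelʳ (sum from) _ _ (begin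
    q ·1 1# + sum from                         ≈⟨ +-congʳ (sum-replicate q) ⟨
    sum {q} (λ _ → 1#) + sum from              ≈⟨ ∑-distrib-+ (λ _ → 1#) from ⟨
    sum (λ i → 1# + from i)                    ≈⟨ sum-cong-≋ (λ i → strictlyInverseʳ (1# + from i)) ⟨
    sum (λ i → from (translation ⟨$⟩ʳ i))      ≈⟨ sum-permute from translation ⟨
    sum from                                   ≈⟨ +-identityˡ _ ⟨
    0# + sum from                              ∎)

  -- A nonzero `p` could be inverted and cancelled from its power one factor at a time, ending in 1
  -- = 0. Whether `p` is zero can be decided because the field is enumerated.
  p≈0 : ∀ p k → (p ℕ.^ k) ·1 1# ≈ 0# → p ·1 1# ≈ 0#
  p≈0 p zero    1≈0 = contradiction (trans (sym (+-identityʳ 1#)) 1≈0) 1≉0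
  p≈0 p (suc k) p^k≈0 with (p ·1 1#) ≟ 0#
  ... | yes p≈0 = p≈0
  ... | no  p≉0 with inverse _ p≉0
  ...   | y , py≈1 = p≈0 p k (begin
    N                      ≈⟨ *-identityˡ _ ⟨
    1# * N                 ≈⟨ *-congʳ (trans (sym py≈1) (*-comm _ _)) ⟩
    (y * (p ·1 1#)) * N    ≈⟨ *-assoc _ _ _ ⟩
    y * ((p ·1 1#) * N)    ≈⟨ *-congˡ (×1-homo-* p (p ℕ.^ k)) ⟨
    y * ((p ℕ.^ suc k) ·1 1#)  ≈⟨ *-congˡ p^k≈0 ⟩
    y * 0#                 ≈⟨ zeroʳ _ ⟩
    0#                     ∎)
    where N = (p ℕ.^ k) ·1 1#

module _ {c ℓ a b} {q : ℕ} {F : Field c ℓ} (F⊇𝔽 : Contains𝔽 q F a b) where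
  open Field F
  open Contains𝔽 F⊇𝔽
  open Exp semiring using (_^_)
  open Mult semiring using () renaming (_×_ to _·1_)

  private
    module 𝔽 = Field 𝔽
    module ×𝔽 = Mult 𝔽.semiring
    module ι = IsRingMonomorphism ι-isMono

    ι-·1 : ∀ n → ι (n ×𝔽.× 𝔽.1#) ≈ n ·1 1#
    ι-·1 zero    = ι.0#-homo
    ι-·1 (suc n) = trans (ι.+-homo _ _) (+-cong ι.1#-homo (ι-·1 n))

  frobenius-+ : ∀ x y → (x + y) ^ q ≈ x ^ q + y ^ q
  frobenius-+ x y with isPrimePower
  ... | p , k , pr , _ , ≡.refl = CharacteristicP.^pᵏ-distrib-+ commutativeRing pr p≈0 k x y
    where
    -- The counting argument applies to the finite field only, so its characteristic is found there
    -- and carried to `F` along `ι`.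
    p≈0 : p ·1 1# ≈ 0#
    p≈0 = trans (sym (ι-·1 p)) (trans
      (ι.⟦⟧-cong (FiniteField.p≈0 𝔽 cardinality p k (FiniteField.q≈0 𝔽 cardinality))) ι.0#-homo)

  1<order : 1 ℕ.< q
  1<order with isPrimePower
  ... | p , suc k , pr , _ , ≡.refl =
    ℕₚ.<-≤-trans (ℕ.nonTrivial⇒n>1 p) (ℕₚ.m≤m*n p (p ℕ.^ k))
    where
    instance
      _ = prime⇒nonTrivial pr
      _ = ℕ.>-nonZero (ℕₚ.<-trans (ℕ.s≤s ℕ.z≤n) (ℕ.nonTrivial⇒n>1 p))
      _ = ℕₚ.m^n≢0 p k

-- Integers inside the rationals, and inequalities between lines

-- Opaque, because _/_ unfolds to a gcd computation.
opaque
  ⟦_⟧ : ℤ → ℚ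
  ⟦ k ⟧ = k / 1

  ⟦⟧≡/1 : ∀ k → ⟦ k ⟧ ≡ k / 1
  ⟦⟧≡/1 k = ≡.refl

  seq-· : ∀ m z n → seq (m · z) n ≡ ⟦ + m ⟧ ℚ.* seq z n
  seq-· m z n = ≡.refl

  ⟦0⟧ : ⟦ + 0 ⟧ ≡ 0ℚ
  ⟦0⟧ = ≡.refl

  ⟦1⟧ : ⟦ + 1 ⟧ ≡ 1ℚ
  ⟦1⟧ = ≡.refl

  ⟦⟧-≃ : ∀ k → toℚᵘ ⟦ k ⟧ ℚᵘ.≃ ℚᵘ.mkℚᵘ k 0
  ⟦⟧-≃ k = ℚₚ.toℚᵘ-fromℚᵘ (ℚᵘ.mkℚᵘ k 0)

  ⟦⟧-+ : ∀ m n → ⟦ m ℤ.+ n ⟧ ≡ ⟦ m ⟧ ℚ.+ ⟦ n ⟧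
  ⟦⟧-+ m n = ℚₚ.toℚᵘ-injective (begin
    toℚᵘ ⟦ m ℤ.+ n ⟧              ≈⟨ ⟦⟧-≃ (m ℤ.+ n) ⟩
    ℚᵘ.mkℚᵘ (m ℤ.+ n) 0           ≈⟨ ℚᵘ.*≡* (≡.cong (ℤ._* (+ 1)) m+n≡) ⟩
    ℚᵘ.mkℚᵘ m 0 ℚᵘ.+ ℚᵘ.mkℚᵘ n 0  ≈⟨ ℚᵘₚ.+-cong (⟦⟧-≃ m) (⟦⟧-≃ n) ⟨
    toℚᵘ ⟦ m ⟧ ℚᵘ.+ toℚᵘ ⟦ n ⟧    ≈⟨ ℚₚ.toℚᵘ-homo-+ ⟦ m ⟧ ⟦ n ⟧ ⟨
    toℚᵘ (⟦ m ⟧ ℚ.+ ⟦ n ⟧)        ∎)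
    where
    open ℚᵘₚ.≃-Reasoning
    m+n≡ : m ℤ.+ n ≡ m ℤ.* + 1 ℤ.+ n ℤ.* + 1
    m+n≡ = ≡.sym (≡.cong₂ ℤ._+_ (ℤₚ.*-identityʳ m) (ℤₚ.*-identityʳ n))

  ⟦⟧-* : ∀ m n → ⟦ m ℤ.* n ⟧ ≡ ⟦ m ⟧ ℚ.* ⟦ n ⟧
  ⟦⟧-* m n = ℚₚ.toℚᵘ-injective (begin
    toℚᵘ ⟦ m ℤ.* n ⟧              ≈⟨ ⟦⟧-≃ (m ℤ.* n) ⟩
    ℚᵘ.mkℚᵘ m 0 ℚᵘ.* ℚᵘ.mkℚᵘ n 0  ≈⟨ ℚᵘₚ.*-cong (⟦⟧-≃ m) (⟦⟧-≃ n) ⟨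
    toℚᵘ ⟦ m ⟧ ℚᵘ.* toℚᵘ ⟦ n ⟧    ≈⟨ ℚₚ.toℚᵘ-homo-* ⟦ m ⟧ ⟦ n ⟧ ⟨
    toℚᵘ (⟦ m ⟧ ℚ.* ⟦ n ⟧)        ∎)
    where open ℚᵘₚ.≃-Reasoning

  ⟦⟧-mono-≤ : ∀ {m n} → m ℤ.≤ n → ⟦ m ⟧ ℚ.≤ ⟦ n ⟧
  ⟦⟧-mono-≤ {m} {n} m≤n = ℚₚ.toℚᵘ-cancel-≤
    (ℚᵘₚ.≤-respˡ-≃ (ℚᵘₚ.≃-sym (⟦⟧-≃ m)) (ℚᵘₚ.≤-respʳ-≃ (ℚᵘₚ.≃-sym (⟦⟧-≃ n))
      (ℚᵘ.*≤* (ℤₚ.*-monoʳ-≤-nonNeg (+ 1) m≤n))))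

  ⟦⟧-cancel-≤ : ∀ {m n} → ⟦ m ⟧ ℚ.≤ ⟦ n ⟧ → m ℤ.≤ n
  ⟦⟧-cancel-≤ {m} {n} m≤n
    with ℚᵘ.*≤* h ← ℚᵘₚ.≤-respˡ-≃ (⟦⟧-≃ m) (ℚᵘₚ.≤-respʳ-≃ (⟦⟧-≃ n) (ℚₚ.toℚᵘ-mono-≤ m≤n))
    = ℤₚ.*-cancelʳ-≤-pos m n (+ 1) h

fromℕ-mono-≤ : ∀ {m n} → m ℕ.≤ n → ⟦ + m ⟧ ℚ.≤ ⟦ + n ⟧
fromℕ-mono-≤ m≤n = ⟦⟧-mono-≤ (ℤ.+≤+ m≤n)

fromℕ-mono-< : ∀ {m n} → m ℕ.< n → ⟦ + m ⟧ ℚ.< ⟦ + n ⟧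
fromℕ-mono-< m<n = ℚₚ.≰⇒> λ n≤m → ℕₚ.<⇒≱ m<n (ℤₚ.drop‿+≤+ (⟦⟧-cancel-≤ n≤m))

fromℕ-suc : ∀ n → ⟦ + suc n ⟧ ≡ 1ℚ ℚ.+ ⟦ + n ⟧
fromℕ-suc n = ≡.trans (⟦⟧-+ (+ 1) (+ n)) (≡.cong (ℚ._+ ⟦ + n ⟧) ⟦1⟧)

0≤fromℕ : ∀ n → 0ℚ ℚ.≤ ⟦ + n ⟧
0≤fromℕ n = ≡.subst (ℚ._≤ ⟦ + n ⟧) ⟦0⟧ (fromℕ-mono-≤ {0} ℕ.z≤n)

0≤q-p : ∀ {p q} → p ℚ.≤ q → 0ℚ ℚ.≤ q ℚ.- p
0≤q-p {p} {q} p≤q = ≡.subst (ℚ._≤ q ℚ.- p) (ℚₚ.+-inverseʳ p) (ℚₚ.+-monoˡ-≤ (ℚ.- p) p≤q)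

0<q-p : ∀ {p q} → p ℚ.< q → 0ℚ ℚ.< q ℚ.- p
0<q-p {p} {q} p<q = ≡.subst (ℚ._< q ℚ.- p) (ℚₚ.+-inverseʳ p) (ℚₚ.+-monoˡ-< (ℚ.- p) p<q)

≤-from-0≤ : ∀ {p q} d → 0ℚ ℚ.≤ d → p ℚ.+ d ≡ q → p ℚ.≤ q
≤-from-0≤ {p} d 0≤d ≡.refl = ≡.subst (ℚ._≤ p ℚ.+ d) (ℚₚ.+-identityʳ p) (ℚₚ.+-monoʳ-≤ p 0≤d)

<-from-0< : ∀ {p q} d → 0ℚ ℚ.< d → p ℚ.+ d ≡ q → p ℚ.< q
<-from-0< {p} d 0<d ≡.refl = ≡.subst (ℚ._< p ℚ.+ d) (ℚₚ.+-identityʳ p) (ℚₚ.+-monoʳ-< p 0<d)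

0≤p*q : ∀ {p q} → 0ℚ ℚ.≤ p → 0ℚ ℚ.≤ q → 0ℚ ℚ.≤ p ℚ.* q
0≤p*q {p} {q} 0≤p 0≤q = ℚₚ.nonNegative⁻¹ _
  {{ℚₚ.nonNeg*nonNeg⇒nonNeg p {{ℚ.nonNegative 0≤p}} q {{ℚ.nonNegative 0≤q}}}}

archimedean : ∀ {δ} → 0ℚ ℚ.< δ → ∀ x → ∃[ n ] (x ℚ.≤ ⟦ + n ⟧ ℚ.* δ)
archimedean {δ} 0<δ x = N , (begin
  x                     ≡⟨ ℚₚ.*-identityʳ x ⟨
  x ℚ.* 1ℚ              ≡⟨ ≡.cong (x ℚ.*_) (≡.sym (ℚₚ.*-inverseˡ δ)) ⟩
  x ℚ.* (1/ δ ℚ.* δ)    ≡⟨ ℚₚ.*-assoc x (1/ δ) δ ⟨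
  x ℚ.* 1/ δ ℚ.* δ      ≤⟨ ℚₚ.*-monoʳ-≤-nonNeg δ (below (x ℚ.* 1/ δ)) ⟩
  ⟦ + N ⟧ ℚ.* δ         ∎)
  where
  open ℚₚ.≤-Reasoning
  instance
    δ-pos : ℚ.Positive δ
    δ-pos = ℚ.positive 0<δ
    δ≢0 : ℚ.NonZero δ
    δ≢0 = ℚₚ.pos⇒nonZero δ
    δ-nonNeg : ℚ.NonNegative δ
    δ-nonNeg = ℚₚ.pos⇒nonNeg δ
  N : ℕ
  -- A rational is at most the absolute value of its numerator, its denominator being at least 1.
  N = ℤ.∣ ℚ.↥ (x ℚ.* 1/ δ) ∣
  below : ∀ y → y ℚ.≤ ⟦ + ℤ.∣ ℚ.↥ y ∣ ⟧
  below y = ℚₚ.toℚᵘ-cancel-≤ (ℚᵘₚ.≤-respʳ-≃ (ℚᵘₚ.≃-sym (⟦⟧-≃ (+ ℤ.∣ ℚ.↥ y ∣))) (bound y))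
    where
    bound : ∀ y → toℚᵘ y ℚᵘ.≤ ℚᵘ.mkℚᵘ (+ ℤ.∣ ℚ.↥ y ∣) 0
    bound (ℚ.mkℚ (+ n)      d _) = ℚᵘ.*≤* (ℤₚ.*-monoˡ-≤-nonNeg (+ n) (ℤ.+≤+ (ℕ.s≤s ℕ.z≤n)))
    bound (ℚ.mkℚ ℤ.-[1+ n ] d _) = ℚᵘ.*≤* ℤ.-≤+

<⇒≱ : ∀ {p q} → p ℚ.< q → ¬ (q ℚ.≤ p)
<⇒≱ p<q q≤p = ℚₚ.<-irrefl ≡.refl (ℚₚ.<-≤-trans p<q q≤p)

-- The difference of the lines has positive slope A - B, hence exactly one zero. The last component
-- is what lets `breakpoint` move its candidate back to the left: wherever the steeper line is
-- already on top, the crossing has been passed.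
crossing : ∀ {A B} c d w → B ℚ.< A → c ℚ.+ A ℚ.* w ℚ.≤ d ℚ.+ B ℚ.* w →
  ∃[ x ] (w ℚ.≤ x × c ℚ.+ A ℚ.* x ≡ d ℚ.+ B ℚ.* x ×
          (∀ x′ → d ℚ.+ B ℚ.* x′ ℚ.≤ c ℚ.+ A ℚ.* x′ → x ℚ.≤ x′))
crossing {A} {B} c d w B<A h = x , w≤x , meets , x≤
  where
  D = A ℚ.- B
  instance
    D-pos : ℚ.Positive D
    D-pos = ℚ.positive (0<q-p B<A)
    D≢0 : ℚ.NonZero D
    D≢0 = ℚₚ.pos⇒nonZero D
  x = 1/ D ℚ.* (d ℚ.- c)
  Dx≡ : D ℚ.* x ≡ d ℚ.- c
  Dx≡ = ≡.trans (≡.sym (ℚₚ.*-assoc D (1/ D) (d ℚ.- c)))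
    (≡.trans (≡.cong (ℚ._* (d ℚ.- c)) (ℚₚ.*-inverseʳ D)) (ℚₚ.*-identityˡ _))
  w≤x : w ℚ.≤ x
  w≤x = ℚₚ.*-cancelˡ-≤-pos D (≡.subst (D ℚ.* w ℚ.≤_) (≡.sym Dx≡)
    (≤-from-0≤ _ (0≤q-p h)
      (solve 5 (λ a b c d w → (a :- b) :* w :+ ((d :+ b :* w) :- (c :+ a :* w)) := d :- c) ≡.refl A B c d w)))
  meets : c ℚ.+ A ℚ.* x ≡ d ℚ.+ B ℚ.* x
  meets = ≡.trans (solve 4 (λ a b c x → c :+ a :* x := c :+ (a :- b) :* x :+ b :* x) ≡.refl A B c x)
    (≡.trans (≡.cong (λ z → c ℚ.+ z ℚ.+ B ℚ.* x) Dx≡)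
      (≡.cong (ℚ._+ B ℚ.* x) (solve 2 (λ c d → c :+ (d :- c) := d) ≡.refl c d)))
  x≤ : ∀ x′ → d ℚ.+ B ℚ.* x′ ℚ.≤ c ℚ.+ A ℚ.* x′ → x ℚ.≤ x′
  x≤ x′ h′ = ℚₚ.*-cancelˡ-≤-pos D (≡.subst (ℚ._≤ D ℚ.* x′) (≡.sym Dx≡)
    (≤-from-0≤ _ (0≤q-p h′)
      (solve 5 (λ a b c d w → (d :- c) :+ ((c :+ a :* w) :- (d :+ b :* w)) := (a :- b) :* w) ≡.refl A B c d x′)))

line-≤ : ∀ {A B x x′} c d → 0ℚ ℚ.≤ (B ℚ.- A) ℚ.* (x′ ℚ.- x) →
  c ℚ.+ A ℚ.* x ℚ.≤ d ℚ.+ B ℚ.* x → c ℚ.+ A ℚ.* x′ ℚ.≤ d ℚ.+ B ℚ.* x′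
line-≤ {A} {B} {x} {x′} c d 0≤ h = ≤-from-0≤ _ (ℚₚ.+-mono-≤ (0≤q-p h) 0≤)
  (solve 6 (λ a b c d x y → (c :+ a :* y) :+ (((d :+ b :* x) :- (c :+ a :* x)) :+ (b :- a) :* (y :- x)) := d :+ b :* y)
    ≡.refl A B c d x x′)

-- The inductive step: A, B are the slopes of V_r, V_b to the left of y′, w′, and ρ + A y′ = V_r(y′).
descent-step : ∀ {A B U ρ c w w′ y y′} → 1ℚ ℚ.≤ B → B ℚ.≤ A → w ℚ.≤ w′ → w′ ℚ.- w ℚ.≤ y′ ℚ.- y →
  U ℚ.≤ ρ ℚ.+ A ℚ.* y → ρ ℚ.+ A ℚ.* y′ ℚ.+ w′ ℚ.≤ c ℚ.+ B ℚ.* w′ ℚ.+ y′ →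
  U ℚ.+ w ℚ.≤ c ℚ.+ B ℚ.* w ℚ.+ y
descent-step {A} {B} {U} {ρ} {c} {w} {w′} {y} {y′} 1≤B B≤A w≤w′ grow h₁ h₂ = ≤-from-0≤ _
  (ℚₚ.+-mono-≤ (ℚₚ.+-mono-≤ (0≤q-p h₁) (0≤q-p h₂))
    (ℚₚ.+-mono-≤ (0≤p*q (0≤q-p B≤A) (ℚₚ.≤-trans (0≤q-p w≤w′) grow)) (0≤p*q (0≤q-p 1≤B) (0≤q-p grow))))
  (solve 9 (λ a b u r k w w′ y y′ →
    (u :+ w) :+ ((((r :+ a :* y) :- u) :+ ((k :+ b :* w′ :+ y′) :- (r :+ a :* y′ :+ w′)))
      :+ ((a :- b) :* (y′ :- y) :+ (b :- con 1ℚ) :* ((y′ :- y) :- (w′ :- w))))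
    := (k :+ b :* w) :+ y) ≡.refl A B U ρ c w w′ y y′)

-- Twisted power series

-- Together with 1 < q, this is what the rest of the argument retains of 𝔽_q.
FrobeniusAdditive : ∀ {c ℓ} → ℕ → Field c ℓ → Set _
FrobeniusAdditive q F = ∀ x y → (x + y) ^ q ≈ x ^ q + y ^ q
  where
  open Field F
  open Exp semiring using (_^_)

module Series {c ℓ} (q : ℕ) (1<q : 1 ℕ.< q) (F : Field c ℓ) (frob : FrobeniusAdditive q F) where
  open Field F
  open Twisted q F
  open Exp semiring using (_^_; ^-congˡ)
  open CommutativeExp commutativeSemiring using (^-distrib-*)
  open CommutativeSemigroupProperties +-commutativeSemigroup using (interchange)
  open RingProperties ring using (-‿distribˡ-*; -‿+-comm)
  open GroupProperties +-group using (x∙y⁻¹≈ε⇒x≈y)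
  open SetoidReasoning setoid

  infix  4 _≋_
  infixl 6 _⊕_
  infixr 7 _⊙_
  infixl 7 _⋆_

  -- Coefficient functions are compared pointwise, which absorbs trailing zeros, and they let the
  -- product recurse on the index. Polynomials enter through `coeff`.
  Series : Set c
  Series = ℕ → Carrier

  _≋_ : Series → Series → Set ℓ
  f ≋ g = ∀ n → f n ≈ g n

  φ : Series → Series
  φ f n = f n ^ q

  _⊕_ : Series → Series → Series
  (f ⊕ g) n = f n + g n

  ⊖_ : Series → Series
  (⊖ f) n = - f n

  _⊙_ : Carrier → Series → Series
  (a ⊙ f) n = a * f n

  -- (f₀ + f′τ) g = f₀ g + f′ φ(g) τ, for power series in τ with coefficients on the left.
  _⋆_ : Series → Series → Series
  (f ⋆ g) zero    = f 0 * g 0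
  (f ⋆ g) (suc n) = f 0 * g (suc n) + (f ∘ suc ⋆ φ g) n

  0^q≈0 : ∀ {x} → x ≈ 0# → x ^ q ≈ 0#
  0^q≈0 {x} x≈0 = vanishes 1<q
    where
    vanishes : ∀ {m n} → m ℕ.< n → x ^ n ≈ 0#
    vanishes {n = suc n} _ = trans (*-congʳ x≈0) (zeroˡ _)

  1^ : ∀ n → 1# ^ n ≈ 1#
  1^ zero    = refl
  1^ (suc n) = trans (*-identityˡ _) (1^ n)

  ⋆-cong : ∀ {f f′ g g′} → f ≋ f′ → g ≋ g′ → f ⋆ g ≋ f′ ⋆ g′
  ⋆-cong f≋ g≋ zero    = *-cong (f≋ 0) (g≋ 0)
  ⋆-cong f≋ g≋ (suc n) = +-cong (*-cong (f≋ 0) (g≋ (suc n)))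
    (⋆-cong (f≋ ∘ suc) (λ i → ^-congˡ q (g≋ i)) n)

  ⋆-zeroˡ : ∀ {f} g → (∀ n → f n ≈ 0#) → ∀ n → (f ⋆ g) n ≈ 0#
  ⋆-zeroˡ g f≈0 zero    = trans (*-congʳ (f≈0 0)) (zeroˡ _)
  ⋆-zeroˡ g f≈0 (suc n) = trans (+-cong (trans (*-congʳ (f≈0 0)) (zeroˡ _)) (⋆-zeroˡ (φ g) (f≈0 ∘ suc) n))
    (+-identityˡ 0#)

  ⋆-distribʳ : ∀ h f g → (f ⊕ g) ⋆ h ≋ f ⋆ h ⊕ g ⋆ h
  ⋆-distribʳ h f g zero    = distribʳ _ _ _
  ⋆-distribʳ h f g (suc n) = trans
    (+-cong (distribʳ _ _ _) (⋆-distribʳ (φ h) (f ∘ suc) (g ∘ suc) n)) (interchange _ _ _ _)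

  ⋆-distribˡ : ∀ f g h → f ⋆ (g ⊕ h) ≋ f ⋆ g ⊕ f ⋆ h
  ⋆-distribˡ f g h zero    = distribˡ _ _ _
  ⋆-distribˡ f g h (suc n) = trans (+-cong (distribˡ _ _ _)
    (trans (⋆-cong (λ _ → refl) (λ i → frob (g i) (h i)) n) (⋆-distribˡ (f ∘ suc) (φ g) (φ h) n)))
    (interchange _ _ _ _)

  ⋆-⊙ : ∀ a f g → (a ⊙ f) ⋆ g ≋ a ⊙ (f ⋆ g)
  ⋆-⊙ a f g zero    = *-assoc _ _ _
  ⋆-⊙ a f g (suc n) = trans (+-cong (*-assoc _ _ _) (⋆-⊙ a (f ∘ suc) (φ g) n)) (sym (distribˡ _ _ _))

  ⋆-⊖ : ∀ f g → (⊖ f) ⋆ g ≋ ⊖ (f ⋆ g)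
  ⋆-⊖ f g zero    = sym (-‿distribˡ-* _ _)
  ⋆-⊖ f g (suc n) = trans (+-cong (sym (-‿distribˡ-* _ _)) (⋆-⊖ (f ∘ suc) (φ g) n)) (-‿+-comm _ _)

  φ-⋆ : ∀ f g → φ (f ⋆ g) ≋ φ f ⋆ φ g
  φ-⋆ f g zero    = ^-distrib-* _ _ q
  φ-⋆ f g (suc n) = trans (frob _ _) (+-cong (^-distrib-* _ _ q) (φ-⋆ (f ∘ suc) (φ g) n))

  ⋆-assoc : ∀ f g h → (f ⋆ g) ⋆ h ≋ f ⋆ (g ⋆ h)
  ⋆-assoc f g h zero    = *-assoc _ _ _
  ⋆-assoc f g h (suc n) = begin
    f 0 * g 0 * h (suc n) + ((f 0 ⊙ (g ∘ suc) ⊕ (f ∘ suc) ⋆ φ g) ⋆ φ h) n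
      ≈⟨ +-cong (*-assoc _ _ _) (⋆-distribʳ (φ h) (f 0 ⊙ (g ∘ suc)) ((f ∘ suc) ⋆ φ g) n) ⟩
    f 0 * (g 0 * h (suc n)) + (((f 0 ⊙ (g ∘ suc)) ⋆ φ h) n + (((f ∘ suc) ⋆ φ g) ⋆ φ h) n)
      ≈⟨ +-congˡ (+-cong (⋆-⊙ (f 0) (g ∘ suc) (φ h) n) (⋆-assoc (f ∘ suc) (φ g) (φ h) n)) ⟩
    f 0 * (g 0 * h (suc n)) + (f 0 * ((g ∘ suc) ⋆ φ h) n + ((f ∘ suc) ⋆ (φ g ⋆ φ h)) n)
      ≈⟨ +-assoc _ _ _ ⟨
    f 0 * (g 0 * h (suc n)) + f 0 * ((g ∘ suc) ⋆ φ h) n + ((f ∘ suc) ⋆ (φ g ⋆ φ h)) n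
      ≈⟨ +-cong (distribˡ _ _ _) (⋆-cong (λ _ → refl) (φ-⋆ g h) n) ⟨
    f 0 * (g 0 * h (suc n) + ((g ∘ suc) ⋆ φ h) n) + ((f ∘ suc) ⋆ φ (g ⋆ h)) n ∎

  -- Right multiplication by τ only shifts coefficients. This reconciles `_*ₚ_`, which multiplies by
  -- τ g, with `_⋆_`, where τ has already been pulled through to give φ(g) τ.
  ⋆-shiftʳ : ∀ f g → g 0 ≈ 0# → ∀ n → (f ⋆ g) (suc n) ≈ (f ⋆ (g ∘ suc)) n
  ⋆-shiftʳ f g g₀≈0 zero    = trans (+-congˡ (trans (*-congˡ (0^q≈0 g₀≈0)) (zeroʳ _))) (+-identityʳ _)
  ⋆-shiftʳ f g g₀≈0 (suc n) = +-congˡ (⋆-shiftʳ (f ∘ suc) (φ g) (0^q≈0 g₀≈0) n)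

  -- Since d₀ = 1, the lowest coefficient of u can be read off from u ⋆ d.
  ⋆-cancelʳ-0 : ∀ {u d} → d 0 ≈ 1# → (∀ n → (u ⋆ d) n ≈ 0#) → ∀ n → u n ≈ 0#
  ⋆-cancelʳ-0 {u} {d} d₀≈1 ud≈0 zero = trans (sym (trans (*-congˡ d₀≈1) (*-identityʳ _))) (ud≈0 0)
  ⋆-cancelʳ-0 {u} {d} d₀≈1 ud≈0 (suc n) = ⋆-cancelʳ-0 {u ∘ suc} {φ d} (trans (^-congˡ q d₀≈1) (1^ q)) tail≈0 n
    where
    u₀≈0 : u 0 ≈ 0#
    u₀≈0 = ⋆-cancelʳ-0 {u} {d} d₀≈1 ud≈0 0
    tail≈0 : ∀ n → ((u ∘ suc) ⋆ φ d) n ≈ 0#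
    tail≈0 n = trans (sym (trans (+-congʳ (trans (*-congʳ u₀≈0) (zeroˡ _))) (+-identityˡ _))) (ud≈0 (suc n))

  ⋆-cancelʳ : ∀ {u v d} → d 0 ≈ 1# → u ⋆ d ≋ v ⋆ d → u ≋ v
  ⋆-cancelʳ {u} {v} {d} d₀≈1 ud≋vd n =
    x∙y⁻¹≈ε⇒x≈y _ _ (⋆-cancelʳ-0 {u ⊕ (⊖ v)} d₀≈1 difference≈0 n)
    where
    difference≈0 : ∀ n → ((u ⊕ (⊖ v)) ⋆ d) n ≈ 0#
    difference≈0 n = begin
      ((u ⊕ (⊖ v)) ⋆ d) n       ≈⟨ ⋆-distribʳ d u (⊖ v) n ⟩
      (u ⋆ d) n + ((⊖ v) ⋆ d) n ≈⟨ +-cong (ud≋vd n) (⋆-⊖ v d n) ⟩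
      (v ⋆ d) n + - (v ⋆ d) n   ≈⟨ -‿inverseʳ _ ⟩
      0#                        ∎

  coeff-+ : ∀ f g → coeff (f +ₚ g) ≋ coeff f ⊕ coeff g
  coeff-+ []      g       n       = sym (+-identityˡ _)
  coeff-+ (a ∷ f) []      n       = sym (+-identityʳ _)
  coeff-+ (a ∷ f) (b ∷ g) zero    = refl
  coeff-+ (a ∷ f) (b ∷ g) (suc n) = coeff-+ f g n

  coeff-map : ∀ {h : Carrier → Carrier} → h 0# ≈ 0# → ∀ f n → coeff (List.map h f) n ≈ h (coeff f n)
  coeff-map h0≈0 []      n       = sym h0≈0
  coeff-map h0≈0 (a ∷ f) zero    = refl
  coeff-map h0≈0 (a ∷ f) (suc n) = coeff-map h0≈0 f n

  coeff-⊙ : ∀ a f → coeff (List.map (a *_) f) ≋ a ⊙ coeff f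
  coeff-⊙ a f = coeff-map (zeroʳ a) f

  coeff-τ : ∀ f n → coeff (τ* f) (suc n) ≈ φ (coeff f) n
  coeff-τ f = coeff-map (0^q≈0 refl) f

  coeff-* : ∀ f g → coeff (f *ₚ g) ≋ coeff f ⋆ coeff g
  coeff-* []      g n       = sym (⋆-zeroˡ (coeff g) (λ _ → refl) n)
  coeff-* (a ∷ f) g zero    = begin
    coeff (List.map (a *_) g +ₚ f *ₚ (τ* g)) 0          ≈⟨ coeff-+ (List.map (a *_) g) (f *ₚ (τ* g)) 0 ⟩
    coeff (List.map (a *_) g) 0 + coeff (f *ₚ (τ* g)) 0 ≈⟨ +-cong (coeff-⊙ a g 0) (coeff-* f (τ* g) 0) ⟩
    a * coeff g 0 + coeff f 0 * 0#                      ≈⟨ +-congˡ (zeroʳ _) ⟩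
    a * coeff g 0 + 0#                                  ≈⟨ +-identityʳ _ ⟩
    a * coeff g 0                                       ∎
  coeff-* (a ∷ f) g (suc n) = begin
    coeff (List.map (a *_) g +ₚ f *ₚ (τ* g)) (suc n)
      ≈⟨ coeff-+ (List.map (a *_) g) (f *ₚ (τ* g)) (suc n) ⟩
    coeff (List.map (a *_) g) (suc n) + coeff (f *ₚ (τ* g)) (suc n)
      ≈⟨ +-cong (coeff-⊙ a g (suc n)) (coeff-* f (τ* g) (suc n)) ⟩
    a * coeff g (suc n) + (coeff f ⋆ coeff (τ* g)) (suc n)
      ≈⟨ +-congˡ (⋆-shiftʳ (coeff f) (coeff (τ* g)) refl n) ⟩
    a * coeff g (suc n) + (coeff f ⋆ (coeff (τ* g) ∘ suc)) n
      ≈⟨ +-congˡ (⋆-cong {f = coeff f} (λ _ → refl) (coeff-τ g) n) ⟩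
    a * coeff g (suc n) + (coeff f ⋆ φ (coeff g)) n ∎

  coeff-beyond : ∀ f {n} → length f ℕ.≤ n → coeff f n ≈ 0#
  coeff-beyond []      _             = refl
  coeff-beyond (a ∷ f) (ℕ.s≤s |f|≤n) = coeff-beyond f |f|≤n

  ≋-sym : ∀ {f g} → f ≋ g → g ≋ f
  ≋-sym f≋g n = sym (f≋g n)

  ≋-trans : ∀ {f g h} → f ≋ g → g ≋ h → f ≋ h
  ≋-trans f≋g g≋h n = trans (f≋g n) (g≋h n)

  ⋆-congˡ : ∀ {f g g′} → g ≋ g′ → f ⋆ g ≋ f ⋆ g′
  ⋆-congˡ {f} = ⋆-cong {f} (λ _ → refl)

  ⋆-congʳ : ∀ {f f′ g} → f ≋ f′ → f ⋆ g ≋ f′ ⋆ g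
  ⋆-congʳ {g = g} f≋f′ = ⋆-cong {g = g} f≋f′ (λ _ → refl)

  ⋆-identityˡ : ∀ g → coeff (1# ∷ []) ⋆ g ≋ g
  ⋆-identityˡ g zero    = *-identityˡ _
  ⋆-identityˡ g (suc n) = trans (+-cong (*-identityˡ _) (⋆-zeroˡ (φ g) (λ _ → refl) n)) (+-identityʳ _)

module NewtonPolygon {c ℓ} (q : ℕ) (1<q : 1 ℕ.< q) (F : Field c ℓ) (frob : FrobeniusAdditive q F)
  (v : DiscreteValuation F) where
  open Field F
  open Twisted q F
  open DiscreteValuation v
  open Series q 1<q F frob
  open Exp semiring using (_^_)
  open CommutativeSemigroupProperties +-commutativeSemigroup using (interchange)
  open RingProperties ring using (-‿distribˡ-*; -‿distribʳ-*; -‿+-comm; -0#≈0#; -‿involutive; -1*x≈-x)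

  -- Valuation bounds

  κ : ℚ
  κ = ⟦ + q ⟧

  1≤κ : 1ℚ ℚ.≤ κ
  1≤κ = ≡.subst (ℚ._≤ κ) ⟦1⟧ (fromℕ-mono-≤ (ℕₚ.<⇒≤ 1<q))

  0≤κ : 0ℚ ℚ.≤ κ
  0≤κ = 0≤fromℕ q

  instance
    κ-nonNeg : ℚ.NonNegative κ
    κ-nonNeg = ℚ.nonNegative 0≤κ

  κ-mono : ∀ {x y} → x ℚ.≤ y → κ ℚ.* x ℚ.≤ κ ℚ.* y
  κ-mono = ℚₚ.*-monoˡ-≤-nonNeg κ

  κ-expand : ∀ {x} → 0ℚ ℚ.≤ x → x ℚ.≤ κ ℚ.* x
  κ-expand {x} 0≤x = ≤-from-0≤ ((κ ℚ.- 1ℚ) ℚ.* x) (0≤p*q (0≤q-p 1≤κ) 0≤x)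
    (solve 2 (λ k x → x :+ (k :- con 1ℚ) :* x := k :* x) ≡.refl κ x)

  -- qⁿ w, by recursion on the same side as in _⋆_.
  weight : ℕ → ℚ → ℚ
  weight zero    w = w
  weight (suc n) w = weight n (κ ℚ.* w)

  weight≡ : ∀ n w → weight n w ≡ ⟦ + (q ℕ.^ n) ⟧ ℚ.* w
  weight≡ zero    w = ≡.sym (≡.trans (≡.cong (ℚ._* w) ⟦1⟧) (ℚₚ.*-identityˡ w))
  weight≡ (suc n) w = begin
    weight n (κ ℚ.* w)                         ≡⟨ weight≡ n (κ ℚ.* w) ⟩
    ⟦ + (q ℕ.^ n) ⟧ ℚ.* (κ ℚ.* w)              ≡⟨ ℚₚ.*-assoc ⟦ + (q ℕ.^ n) ⟧ κ w ⟨
    (⟦ + (q ℕ.^ n) ⟧ ℚ.* κ) ℚ.* w              ≡⟨ ≡.cong (ℚ._* w) (⟦⟧-* (+ (q ℕ.^ n)) (+ q)) ⟨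
    ⟦ + (q ℕ.^ n) ℤ.* + q ⟧ ℚ.* w              ≡⟨ ≡.cong (λ k → ⟦ k ⟧ ℚ.* w) (ℤₚ.pos-* (q ℕ.^ n) q) ⟨
    ⟦ + (q ℕ.^ n ℕ.* q) ⟧ ℚ.* w                ≡⟨ ≡.cong (λ k → ⟦ + k ⟧ ℚ.* w) (ℕₚ.*-comm (q ℕ.^ n) q) ⟩
    ⟦ + (q ℕ.^ suc n) ⟧ ℚ.* w                  ∎
    where open ≡.≡-Reasoning

  infix 4 _≤[_]⊞_

  -- M ≤ ν x + W in ℚ ∪ {∞}
  record _≤[_]⊞_ (M : ℚ) (x : Carrier) (W : ℚ) : Set where
    constructor bd
    field at : ∀ {k} → ν x ≡ [ k ] → M ℚ.≤ ⟦ k ⟧ ℚ.+ W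
  open _≤[_]⊞_

  ν≈0 : ∀ {x} → x ≈ 0# → ν x ≡ ⊤⁺
  ν≈0 {x} = Equivalence.from (ν≡∞⇔≈0 x)

  data View (x : Carrier) : Set ℓ where
    isZero : x ≈ 0# → View x
    hasVal : ∀ k → ν x ≡ [ k ] → View x

  view : ∀ x → View x
  view x with ν x in eq
  ... | just k  = hasVal k eq
  ... | nothing = isZero (Equivalence.to (ν≡∞⇔≈0 x) eq)

  ν-finite : ∀ {x} → ¬ x ≈ 0# → ∃[ k ] (ν x ≡ [ k ])
  ν-finite {x} x≉0 with view x
  ... | isZero x≈0   = contradiction x≈0 x≉0
  ... | hasVal k eq  = k , eq

  finite≉0 : ∀ {x k} → ν x ≡ [ k ] → ¬ x ≈ 0#
  finite≉0 eq x≈0 with () ← ≡.trans (≡.sym eq) (ν≈0 x≈0)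

  [-]-inj : ∀ {j k : ℤ} → _≡_ {A = ℤ ⁺} [ j ] [ k ] → j ≡ k
  [-]-inj = just-injective

  bd-attained : ∀ {M x W k} → ν x ≡ [ k ] → M ℚ.≤ ⟦ k ⟧ ℚ.+ W → M ≤[ x ]⊞ W
  bd-attained {M} {x} {W} eq h .at eq′ =
    ≡.subst (λ k → M ℚ.≤ ⟦ k ⟧ ℚ.+ W) ([-]-inj (≡.trans (≡.sym eq) eq′)) h

  bd-≈0 : ∀ {M x W} → x ≈ 0# → M ≤[ x ]⊞ W
  bd-≈0 x≈0 .at eq = contradiction x≈0 (finite≉0 eq)

  bd-cong : ∀ {M x y W} → x ≈ y → M ≤[ x ]⊞ W → M ≤[ y ]⊞ W
  bd-cong x≈y h .at eq = at h (≡.trans (ν-cong x≈y) eq)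

  bd-weaken : ∀ {M N x W} → N ℚ.≤ M → M ≤[ x ]⊞ W → N ≤[ x ]⊞ W
  bd-weaken N≤M h .at eq = ℚₚ.≤-trans N≤M (at h eq)

  bd-shift : ∀ {M x W} d → M ≤[ x ]⊞ W → M ℚ.+ d ≤[ x ]⊞ W ℚ.+ d
  bd-shift {M} {x} {W} d h .at {k} eq = ≡.subst (M ℚ.+ d ℚ.≤_) (ℚₚ.+-assoc ⟦ k ⟧ W d) (ℚₚ.+-monoˡ-≤ d (at h eq))

  bd-+ : ∀ {M x y W} → M ≤[ x ]⊞ W → M ≤[ y ]⊞ W → M ≤[ x + y ]⊞ W
  bd-+ {M} {x} {y} {W} hx hy .at {k} eq with view x | view y
  ... | isZero x≈0 | _ = at hy (≡.trans (ν-cong (sym (trans (+-congʳ x≈0) (+-identityˡ y)))) eq)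
  ... | hasVal _ _ | isZero y≈0 = at hx (≡.trans (ν-cong (sym (trans (+-congˡ y≈0) (+-identityʳ x)))) eq)
  ... | hasVal i ex | hasVal j ey = go (≡.subst ([ i ℤ.⊓ j ] ≤∞_) eq
    (≡.subst₂ (λ s t → s ⊓∞ t ≤∞ ν (x + y)) ex ey (ν-+ x y)))
    where
    go : [ i ℤ.⊓ j ] ≤∞ [ k ] → M ℚ.≤ ⟦ k ⟧ ℚ.+ W
    go [ i⊓j≤k ] with ℤₚ.⊓-sel i j
    ... | inj₁ i⊓j≡i = ℚₚ.≤-trans (at hx ex) (ℚₚ.+-monoˡ-≤ W (⟦⟧-mono-≤ (≡.subst (ℤ._≤ k) i⊓j≡i i⊓j≤k)))
    ... | inj₂ i⊓j≡j = ℚₚ.≤-trans (at hy ey) (ℚₚ.+-monoˡ-≤ W (⟦⟧-mono-≤ (≡.subst (ℤ._≤ k) i⊓j≡j i⊓j≤k)))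

  ν-*-finite : ∀ {x y j k} → ν x ≡ [ j ] → ν y ≡ [ k ] → ν (x * y) ≡ [ j ℤ.+ k ]
  ν-*-finite {x} {y} ex ey = ≡.trans (ν-* x y) (≡.cong₂ _+∞_ ex ey)

  -- Bounds compose instead of adding up: the bound `V` obtained for `y` is the argument at which
  -- `x` is estimated. For constants this is V_{xy} = V_x ∘ V_y.
  bd-* : ∀ {U x V y W} → U ≤[ x ]⊞ V → V ≤[ y ]⊞ W → U ≤[ x * y ]⊞ W
  bd-* {U} {x} {V} {y} {W} hx hy with view x | view y
  ... | isZero x≈0 | _ = bd-≈0 (trans (*-congʳ x≈0) (zeroˡ y))
  ... | hasVal _ _ | isZero y≈0 = bd-≈0 (trans (*-congˡ y≈0) (zeroʳ x))
  ... | hasVal i ex | hasVal j ey = bd-attained (ν-*-finite ex ey) (begin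
    U                              ≤⟨ at hx ex ⟩
    ⟦ i ⟧ ℚ.+ V                    ≤⟨ ℚₚ.+-monoʳ-≤ ⟦ i ⟧ (at hy ey) ⟩
    ⟦ i ⟧ ℚ.+ (⟦ j ⟧ ℚ.+ W)        ≡⟨ ℚₚ.+-assoc ⟦ i ⟧ ⟦ j ⟧ W ⟨
    (⟦ i ⟧ ℚ.+ ⟦ j ⟧) ℚ.+ W        ≡⟨ ≡.cong (ℚ._+ W) (⟦⟧-+ i j) ⟨
    ⟦ i ℤ.+ j ⟧ ℚ.+ W              ∎)
    where open ℚₚ.≤-Reasoning

  double≡0 : ∀ k → k ℤ.+ k ≡ ℤ.+ 0 → k ≡ ℤ.+ 0
  double≡0 (ℤ.+ zero)   _ = ≡.refl
  double≡0 (ℤ.+ suc n)  ()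
  double≡0 ℤ.-[1+ n ]   ()

  ν-1 : ν 1# ≡ [ ℤ.+ 0 ]
  ν-1 with ν-finite 1≉0
  ... | k , eq = ≡.trans eq (≡.cong [_] (AbelianGroupProperties.∙-cancelˡ ℤₚ.+-0-abelianGroup k _ _
    ([-]-inj (≡.trans (≡.trans (≡.sym (ν-*-finite eq eq)) (≡.trans (ν-cong (*-identityˡ 1#)) eq)) (≡.cong [_] (≡.sym (ℤₚ.+-identityʳ k)))))))

  ν-[-1] : ν (- 1#) ≡ [ ℤ.+ 0 ]
  ν-[-1] with ν-finite (λ -1≈0 → 1≉0 (trans (sym (-‿involutive 1#)) (trans (-‿cong -1≈0) -0#≈0#)))
  ... | k , eq = ≡.trans eq (≡.cong [_] (double≡0 k ([-]-inj (≡.trans (≡.sym (ν-*-finite eq eq))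
    (≡.trans (ν-cong (trans (-1*x≈-x (- 1#)) (-‿involutive 1#))) ν-1)))))

  ν-neg : ∀ {x k} → ν x ≡ [ k ] → ν (- x) ≡ [ k ]
  ν-neg {x} {k} eq = ≡.trans (ν-cong (sym (-1*x≈-x x))) (≡.trans (ν-*-finite ν-[-1] eq) (≡.cong [_] (ℤₚ.+-identityˡ k)))

  bd-neg : ∀ {M x W} → M ≤[ x ]⊞ W → M ≤[ - x ]⊞ W
  bd-neg {x = x} h .at eq = at h (≡.trans (ν-cong (sym (-‿involutive x))) (ν-neg eq))

  ν-^ : ∀ {x k} n → ν x ≡ [ k ] → ν (x ^ n) ≡ [ ℤ.+ n ℤ.* k ]
  ν-^ zero    eq = ν-1
  ν-^ {x} {k} (suc n) eq = ≡.trans (ν-*-finite eq (ν-^ n eq)) (≡.cong [_] (≡.sym (ℤₚ.suc-* (ℤ.+ n) k)))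

  κ-distrib : ∀ k W → ⟦ + q ℤ.* k ⟧ ℚ.+ κ ℚ.* W ≡ κ ℚ.* (⟦ k ⟧ ℚ.+ W)
  κ-distrib k W = ≡.trans (≡.cong (ℚ._+ κ ℚ.* W) (⟦⟧-* (+ q) k)) (≡.sym (ℚₚ.*-distribˡ-+ κ ⟦ k ⟧ W))

  bd-^q : ∀ {M x W} → M ≤[ x ]⊞ W → κ ℚ.* M ≤[ x ^ q ]⊞ κ ℚ.* W
  bd-^q {M} {x} {W} h with view x
  ... | isZero x≈0  = bd-≈0 (0^q≈0 x≈0)
  ... | hasVal k eq = bd-attained (ν-^ q eq) (≡.subst (κ ℚ.* M ℚ.≤_) (≡.sym (κ-distrib k W)) (κ-mono (at h eq)))

  -- Since x = (x + y) - y, a value of x + y above `k` would force ν x above `k` as well. Only a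
  -- lower bound for `y` is at hand, so the value of x + y is compared with `M` to see which of the
  -- two limits the sum.
  ν-+-dominant : ∀ {x y k M W} → ν x ≡ [ k ] → M ≤[ y ]⊞ W → ⟦ k ⟧ ℚ.+ W ℚ.< M → ν (x + y) ≡ [ k ]
  ν-+-dominant {x} {y} {k} {M} {W} ex hy k+W<M = case (view (x + y))
    where
    x≈ : (x + y) + - y ≈ x
    x≈ = trans (+-assoc _ _ _) (trans (+-congˡ (-‿inverseʳ y)) (+-identityʳ x))
    back : ∀ {N} → N ≤[ x + y ]⊞ W → N ℚ.≤ M → N ℚ.≤ ⟦ k ⟧ ℚ.+ W
    back h N≤M = at (bd-cong x≈ (bd-+ h (bd-neg (bd-weaken N≤M hy)))) ex
    case : View (x + y) → ν (x + y) ≡ [ k ]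
    case (isZero s≈0) = contradiction (back (bd-≈0 s≈0) ℚₚ.≤-refl) (<⇒≱ k+W<M)
    case (hasVal m eq) = ≡.trans eq (≡.cong [_] (ℤₚ.≤-antisym m≤k k≤m))
      where
      drop : ∀ {i j} → ⟦ i ⟧ ℚ.+ W ℚ.≤ ⟦ j ⟧ ℚ.+ W → i ℤ.≤ j
      drop {i} {j} h = ⟦⟧-cancel-≤ (≡.subst₂ ℚ._≤_ (undo i) (undo j) (ℚₚ.+-monoˡ-≤ (ℚ.- W) h))
        where
        undo : ∀ i → (⟦ i ⟧ ℚ.+ W) ℚ.- W ≡ ⟦ i ⟧
        undo i = solve 2 (λ x w → (x :+ w) :- w := x) ≡.refl ⟦ i ⟧ W
      k≤m : k ℤ.≤ m
      k≤m = drop (at (bd-+ (bd-attained ex ℚₚ.≤-refl) (bd-weaken (ℚₚ.<⇒≤ k+W<M) hy)) eq)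
      m≤k : m ℤ.≤ k
      m≤k with ℚₚ.≤-total (⟦ m ⟧ ℚ.+ W) M
      ... | inj₁ m+W≤M = drop (back (bd-attained eq ℚₚ.≤-refl) m+W≤M)
      ... | inj₂ M≤m+W = contradiction (back (bd-attained eq M≤m+W) ℚₚ.≤-refl) (<⇒≱ k+W<M)

  -- Gauss norms

  -- This says M ≤ V_f(w) without presupposing that the minimum exists; a series may be zero or have
  -- infinitely many nonzero coefficients.
  Bound : Series → ℚ → ℚ → Set
  Bound f w M = ∀ n → M ≤[ f n ]⊞ weight n w

  bound-weaken : ∀ {f w M N} → N ℚ.≤ M → Bound f w M → Bound f w N
  bound-weaken N≤M h n = bd-weaken N≤M (h n)

  weight-κ : ∀ n w → weight n (κ ℚ.* w) ≡ κ ℚ.* weight n w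
  weight-κ zero    w = ≡.refl
  weight-κ (suc n) w = weight-κ n (κ ℚ.* w)

  bd-φ : ∀ {f w M} n → M ≤[ f n ]⊞ weight n w → κ ℚ.* M ≤[ φ f n ]⊞ weight n (κ ℚ.* w)
  bd-φ {w = w} n h rewrite weight-κ n w = bd-^q h

  bound-φ : ∀ {f w M} → Bound f w M → Bound (φ f) (κ ℚ.* w) (κ ℚ.* M)
  bound-φ {f} h n = bd-φ {f} n (h n)

  -- The inequality half of the Gauss lemma. In f g = f₀ g + f′ φ(g) τ, passing to f′ multiplies the
  -- argument `V` by κ, and passing to φ(g) multiplies both `w` and its bound by κ, so the recursion
  -- closes.
  bound-⋆ : ∀ {f g V w U} → Bound f V U → Bound g w V → Bound (f ⋆ g) w U
  bound-⋆ hf hg zero    = bd-* (hf 0) (hg 0)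
  bound-⋆ {f} {g} hf hg (suc n) = bd-+ (bd-* (hf 0) (hg (suc n)))
    (bound-⋆ {f ∘ suc} {φ g} (hf ∘ suc) (bound-φ {g} hg) n)

  bound-coeff : ∀ f w → ∃[ M ] Bound (coeff f) w M
  bound-coeff []      w = 0ℚ , λ _ → bd-≈0 refl
  bound-coeff (a ∷ f) w with bound-coeff f (κ ℚ.* w) | view a
  ... | M , h | isZero a≈0  = M , λ { zero → bd-≈0 a≈0 ; (suc n) → h n }
  ... | M , h | hasVal k eq = M ℚ.⊓ (⟦ k ⟧ ℚ.+ w) , λ
    { zero    → bd-attained eq (ℚₚ.p⊓q≤q M _)
    ; (suc n) → bd-weaken (ℚₚ.p⊓q≤p M _) (h n) }

  -- V is the minimum of ν (f n) + qⁿ w; K is the last index at which it is attained.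
  record Lead (f : Series) (w : ℚ) (K : ℕ) (V δ : ℚ) : Set where
    field
      val   : ℤ
      ν-K   : ν (f K) ≡ [ val ]
      V≡    : ⟦ val ⟧ ℚ.+ weight K w ≡ V
      bound : Bound f w V
      δ>0   : 0ℚ ℚ.< δ
      gap   : ∀ n → K ℕ.< n → V ℚ.+ δ ≤[ f n ]⊞ weight n w
  open Lead public

  p<p+δ : ∀ {p δ} → 0ℚ ℚ.< δ → p ℚ.< p ℚ.+ δ
  p<p+δ {p} {δ} 0<δ = <-from-0< δ 0<δ ≡.refl

  lead-δ : ∀ {f w K V δ δ′} → 0ℚ ℚ.< δ′ → δ′ ℚ.≤ δ → Lead f w K V δ → Lead f w K V δ′
  lead-δ {V = V} 0<δ′ δ′≤δ L = record
    { val = val L ; ν-K = ν-K L ; V≡ = V≡ L ; bound = bound L ; δ>0 = 0<δ′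
    ; gap = λ n K<n → bd-weaken (ℚₚ.+-monoʳ-≤ V δ′≤δ) (gap L n K<n) }

  lead-tail : ∀ {f w K V δ} → Lead f w (suc K) V δ → Lead (f ∘ suc) (κ ℚ.* w) K V δ
  lead-tail L = record
    { val = val L ; ν-K = ν-K L ; V≡ = V≡ L ; bound = bound L ∘ suc ; δ>0 = δ>0 L
    ; gap = λ n K<n → gap L (suc n) (ℕ.s≤s K<n) }

  lead-φ : ∀ {f w K V δ} → Lead f w K V δ → Lead (φ f) (κ ℚ.* w) K (κ ℚ.* V) δ
  lead-φ {f} {w} {K} {V} {δ} L = record
    { val   = + q ℤ.* val L
    ; ν-K   = ν-^ q (ν-K L)
    ; V≡    = ≡.trans (≡.cong (⟦ + q ℤ.* val L ⟧ ℚ.+_) (weight-κ K w))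
                (≡.trans (κ-distrib (val L) (weight K w)) (≡.cong (κ ℚ.*_) (V≡ L)))
    ; bound = bound-φ {f} (bound L)
    ; δ>0   = δ>0 L
    ; gap   = λ n K<n → bd-weaken κV+δ≤ (bd-φ {f} n (gap L n K<n)) }
    where
    κV+δ≤ : κ ℚ.* V ℚ.+ δ ℚ.≤ κ ℚ.* (V ℚ.+ δ)
    κV+δ≤ = ≡.subst (κ ℚ.* V ℚ.+ δ ℚ.≤_) (≡.sym (ℚₚ.*-distribˡ-+ κ V δ))
      (ℚₚ.+-monoʳ-≤ (κ ℚ.* V) (κ-expand (ℚₚ.<⇒≤ (δ>0 L))))

  lead? : ∀ f w → (∀ n → coeff f n ≈ 0#) ⊎ ∃[ K ] ∃[ V ] ∃[ δ ] Lead (coeff f) w K V δ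
  lead? []      w = inj₁ λ _ → refl
  lead? (a ∷ f) w with lead? f (κ ℚ.* w) | view a
  ... | inj₁ f≈0 | isZero a≈0 = inj₁ λ { zero → a≈0 ; (suc n) → f≈0 n }
  ... | inj₁ f≈0 | hasVal k eq = inj₂ (0 , _ , 1ℚ , record
    { val = k ; ν-K = eq ; V≡ = ≡.refl
    ; bound = λ { zero → bd-attained eq ℚₚ.≤-refl ; (suc n) → bd-≈0 (f≈0 n) }
    ; δ>0 = ℚₚ.positive⁻¹ 1ℚ
    ; gap = λ { (suc n) _ → bd-≈0 (f≈0 n) } })
  ... | inj₂ (K , V , δ , L) | isZero a≈0 = inj₂ (suc K , V , δ , record
    { val = val L ; ν-K = ν-K L ; V≡ = V≡ L
    ; bound = λ { zero → bd-≈0 a≈0 ; (suc n) → bound L n }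
    ; δ>0 = δ>0 L
    ; gap = λ { (suc n) (ℕ.s≤s K<n) → gap L n K<n } })
  ... | inj₂ (K , V , δ , L) | hasVal k eq with ℚₚ._≤?_ V (⟦ k ⟧ ℚ.+ w)
  -- A tie goes to the tail, because the last minimising index is wanted.
  ...   | yes V≤ = inj₂ (suc K , V , δ , record
    { val = val L ; ν-K = ν-K L ; V≡ = V≡ L
    ; bound = λ { zero → bd-attained eq V≤ ; (suc n) → bound L n }
    ; δ>0 = δ>0 L
    ; gap = λ { (suc n) (ℕ.s≤s K<n) → gap L n K<n } })
  ...   | no V≰ = inj₂ (0 , ⟦ k ⟧ ℚ.+ w , V ℚ.- (⟦ k ⟧ ℚ.+ w) , record
    { val = k ; ν-K = eq ; V≡ = ≡.refl
    ; bound = λ { zero → bd-attained eq ℚₚ.≤-refl ; (suc n) → bd-weaken (ℚₚ.<⇒≤ (ℚₚ.≰⇒> V≰)) (bound L n) }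
    ; δ>0 = 0<q-p (ℚₚ.≰⇒> V≰)
    ; gap = λ { (suc n) _ → bd-weaken (ℚₚ.≤-reflexive (cancel (⟦ k ⟧ ℚ.+ w) V)) (bound L n) } })
    where
    cancel : ∀ x y → x ℚ.+ (y ℚ.- x) ≡ y
    cancel = solve 2 (λ x y → x :+ (y :- x) := y) ≡.refl

  lead-of : ∀ f w {n} → ¬ coeff f n ≈ 0# → ∃[ K ] ∃[ V ] ∃[ δ ] Lead (coeff f) w K V δ
  lead-of f w {n} fₙ≉0 with lead? f w
  ... | inj₁ f≈0 = contradiction (f≈0 n) fₙ≉0
  ... | inj₂ L   = L

  -- The equality half of the Gauss lemma. In coefficient J + K, a term fᵢ gⱼ^(qⁱ) with i < J has j
  -- > K and gains at least δ from `g`; one with i > J gains δ from `f`. The single term i = J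
  -- therefore dominates. Beyond J + K every term has i > J or j > K.
  lead-⋆ : ∀ {f g V w J K U δ} → Lead f V J U δ → Lead g w K V δ → Lead (f ⋆ g) w (J ℕ.+ K) U δ
  lead-⋆ {f} {g} {V} {w} {J} {K} {U} {δ} Lf Lg = record
    { val = proj₁ (main Lf Lg) ; ν-K = proj₁ (proj₂ (main Lf Lg)) ; V≡ = proj₂ (proj₂ (main Lf Lg))
    ; bound = bound-⋆ {f} {g} (bound Lf) (bound Lg) ; δ>0 = δ>0 Lf ; gap = λ n → beyond n Lf Lg }
    where
    beyond : ∀ {f g V w J K U δ} n → Lead f V J U δ → Lead g w K V δ → J ℕ.+ K ℕ.< n →
             U ℚ.+ δ ≤[ (f ⋆ g) n ]⊞ weight n w
    beyond {f} {g} {J = zero} {δ = δ} (suc n) Lf Lg K<n = bd-+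
      (bd-* (bd-shift δ (bound Lf 0)) (gap Lg (suc n) K<n))
      (bound-⋆ {f ∘ suc} {φ g} (λ i → gap Lf (suc i) (ℕ.s≤s ℕ.z≤n)) (bound-φ {g} (bound Lg)) n)
    beyond {f} {g} {J = suc J} {K} {δ = δ} (suc n) Lf Lg (ℕ.s≤s J+K<n) = bd-+
      (bd-* (bd-shift δ (bound Lf 0)) (gap Lg (suc n) (ℕ.s≤s (ℕₚ.≤-trans (ℕₚ.m≤n+m K J) (ℕₚ.<⇒≤ J+K<n)))))
      (beyond n (lead-tail Lf) (lead-φ Lg) J+K<n)

    main : ∀ {f g V w J K U δ} → Lead f V J U δ → Lead g w K V δ →
           ∃[ k ] (ν ((f ⋆ g) (J ℕ.+ K)) ≡ [ k ] × ⟦ k ⟧ ℚ.+ weight (J ℕ.+ K) w ≡ U)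
    main {f} {g} {V} {w} {zero} {K} {U} {δ} Lf Lg = _ , leading K ≡.refl , total
      where
      total : ⟦ val Lf ℤ.+ val Lg ⟧ ℚ.+ weight K w ≡ U
      total = begin
        ⟦ val Lf ℤ.+ val Lg ⟧ ℚ.+ weight K w           ≡⟨ ≡.cong (ℚ._+ weight K w) (⟦⟧-+ (val Lf) (val Lg)) ⟩
        (⟦ val Lf ⟧ ℚ.+ ⟦ val Lg ⟧) ℚ.+ weight K w     ≡⟨ ℚₚ.+-assoc ⟦ val Lf ⟧ ⟦ val Lg ⟧ (weight K w) ⟩
        ⟦ val Lf ⟧ ℚ.+ (⟦ val Lg ⟧ ℚ.+ weight K w)     ≡⟨ ≡.cong (⟦ val Lf ⟧ ℚ.+_) (V≡ Lg) ⟩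
        ⟦ val Lf ⟧ ℚ.+ V                               ≡⟨ V≡ Lf ⟩
        U                                              ∎
        where open ≡.≡-Reasoning
      leading : ∀ n → n ≡ K → ν ((f ⋆ g) n) ≡ [ val Lf ℤ.+ val Lg ]
      leading zero    ≡.refl = ν-*-finite (ν-K Lf) (ν-K Lg)
      leading (suc n) ≡.refl = ν-+-dominant (ν-*-finite (ν-K Lf) (ν-K Lg))
        (bound-⋆ {f ∘ suc} {φ g} (λ i → gap Lf (suc i) (ℕ.s≤s ℕ.z≤n)) (bound-φ {g} (bound Lg)) n)
        (≡.subst (ℚ._< U ℚ.+ δ) (≡.sym total) (p<p+δ (δ>0 Lf)))
    main {f} {g} {V} {w} {suc J} {K} {U} {δ} Lf Lg
      with main (lead-tail Lf) (lead-φ Lg)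
    ... | k , eq , total = k , ≡.trans (ν-cong (+-comm _ _)) (ν-+-dominant eq
      (bd-* (bd-shift δ (bound Lf 0)) (gap Lg (suc (J ℕ.+ K)) (ℕ.s≤s (ℕₚ.m≤n+m K J))))
      (≡.subst (ℚ._< U ℚ.+ δ) (≡.sym total) (p<p+δ (δ>0 Lf)))) , total

  open SetoidReasoning setoid

  -- Linear dependence

  dot : Poly → Series → Carrier
  dot []      u = 0#
  dot (a ∷ x) u = a * u 0 + dot x (u ∘ suc)

  dot-cong : ∀ x {u u′} → u ≋ u′ → dot x u ≈ dot x u′
  dot-cong []      u≋ = refl
  dot-cong (a ∷ x) u≋ = +-cong (*-congˡ (u≋ 0)) (dot-cong x (u≋ ∘ suc))

  dot-+ : ∀ x u w → dot x (u ⊕ w) ≈ dot x u + dot x w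
  dot-+ []      u w = sym (+-identityˡ 0#)
  dot-+ (a ∷ x) u w = trans (+-cong (distribˡ _ _ _) (dot-+ x (u ∘ suc) (w ∘ suc))) (interchange _ _ _ _)

  dot-*ʳ : ∀ x u b → dot x (λ i → u i * b) ≈ dot x u * b
  dot-*ʳ []      u b = sym (zeroˡ b)
  dot-*ʳ (a ∷ x) u b = trans (+-cong (sym (*-assoc _ _ _)) (dot-*ʳ x (u ∘ suc) b)) (sym (distribʳ _ _ _))

  dot-neg : ∀ x u → dot x (⊖ u) ≈ - dot x u
  dot-neg []      u = sym -0#≈0#
  dot-neg (a ∷ x) u = trans (+-cong (sym (-‿distribʳ-* _ _)) (dot-neg x (u ∘ suc))) (-‿+-comm _ _)

  data Row (u : Series) (n : ℕ) : Set ℓ where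
    allZero : (∀ m → m ℕ.< n → u m ≈ 0#) → Row u n
    pivot   : ∀ p → p ℕ.< n → ¬ u p ≈ 0# → Row u n

  row : ∀ u n → Row u n
  row u zero = allZero λ _ ()
  row u (suc n) with view (u n) | row u n
  ... | hasVal k eq | _             = pivot n (ℕₚ.n<1+n n) (finite≉0 eq)
  ... | isZero _    | pivot p p<n h = pivot p (ℕₚ.<-trans p<n (ℕₚ.n<1+n n)) h
  ... | isZero uₙ≈0 | allZero u≈0   = allZero below
    where
    below : ∀ m → m ℕ.< suc n → u m ≈ 0#
    below m m<1+n with ℕₚ.m≤n⇒m<n∨m≡n (ℕ.s≤s⁻¹ m<1+n)
    ... | inj₁ m<n    = u≈0 m m<n
    ... | inj₂ ≡.refl = uₙ≈0

  -- Gaussian elimination for n homogeneous equations in n + 1 unknowns, indexed by `m` and `i`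
  -- respectively. The solution is a list, so that it can be read as a twisted polynomial of degree
  -- at most n.
  dependence : ∀ n (A : ℕ → Series) → ∃[ x ] (length x ℕ.≤ suc n × (∃[ i ] ¬ coeff x i ≈ 0#) ×
    (∀ m → m ℕ.< n → dot x (λ i → A i m) ≈ 0#))
  dependence zero    A = 1# ∷ [] , ℕₚ.≤-refl , (0 , 1≉0) , λ _ ()
  dependence (suc n) A with row (A 0) (suc n)
  ... | allZero A₀≈0 = 1# ∷ [] , ℕ.s≤s ℕ.z≤n , (0 , 1≉0) ,
        λ m m<n → trans (+-identityʳ _) (trans (*-identityˡ _) (A₀≈0 m m<n))
  ... | pivot p p<1+n A₀ₚ≉0 with inverse _ A₀ₚ≉0
  ...   | b , A₀ₚb≈1 with dependence n (λ i m → A′ (suc i) (column m))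
    where
    A′ : ℕ → ℕ → Carrier
    A′ i m = A i m + - (A i p * (b * A 0 m))
    -- The pivot equation is dropped, and equation `n`, which would fall out of range, takes over
    -- its number.
    column : ℕ → ℕ
    column m with m ℕₚ.≟ p
    ... | yes _ = n
    ... | no  _ = m
  ...     | x , |x|≤ , (i , xᵢ≉0) , x·A′≈0 = x₀ ∷ x , ℕ.s≤s |x|≤ , (suc i , xᵢ≉0) , kills
    where
    col : ℕ → Series
    col m i = A (suc i) m
    -- The pivot equation, solved for the eliminated unknown.
    x₀ : Carrier
    x₀ = - (dot x (col p) * b)

    A″ : ℕ → ℕ → Carrier
    A″ i m = A (suc i) m + - (A (suc i) p * (b * A 0 m))

    reduced : ∀ m → dot x (λ i → A″ i m) ≈ dot x (col m) + x₀ * A 0 m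
    reduced m = begin
      dot x (λ i → A″ i m)
        ≈⟨ dot-+ x (col m) (λ i → - (A (suc i) p * (b * A 0 m))) ⟩
      dot x (col m) + dot x (λ i → - (A (suc i) p * (b * A 0 m)))
        ≈⟨ +-congˡ (trans (dot-neg x (λ i → A (suc i) p * (b * A 0 m))) (-‿cong (dot-*ʳ x (col p) (b * A 0 m)))) ⟩
      dot x (col m) + - (dot x (col p) * (b * A 0 m))
        ≈⟨ +-congˡ (trans (-‿cong (sym (*-assoc _ _ _))) (-‿distribˡ-* _ _)) ⟩
      dot x (col m) + x₀ * A 0 m ∎

    kills-p : x₀ * A 0 p + dot x (col p) ≈ 0#
    kills-p = begin
      x₀ * A 0 p + dot x (col p)
        ≈⟨ +-congʳ (trans (sym (-‿distribˡ-* _ _)) (-‿cong (*-assoc _ _ _))) ⟩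
      - (dot x (col p) * (b * A 0 p)) + dot x (col p)
        ≈⟨ +-congʳ (-‿cong (trans (*-congˡ (trans (*-comm _ _) A₀ₚb≈1)) (*-identityʳ _))) ⟩
      - dot x (col p) + dot x (col p)
        ≈⟨ -‿inverseˡ _ ⟩
      0# ∎

    A″≈0 : ∀ m → ¬ m ≡ p → m ℕ.< suc n → dot x (λ i → A″ i m) ≈ 0#
    A″≈0 m m≢p m<1+n with ℕₚ.m≤n⇒m<n∨m≡n (ℕ.s≤s⁻¹ m<1+n)
    ... | inj₁ m<n with x·A′≈0 m m<n
    ...   | h with m ℕₚ.≟ p
    ...     | yes m≡p = contradiction m≡p m≢p
    ...     | no  _   = h
    A″≈0 m m≢p m<1+n | inj₂ ≡.refl with x·A′≈0 p (ℕₚ.≤∧≢⇒< (ℕ.s≤s⁻¹ p<1+n) (m≢p ∘ ≡.sym))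
    ...   | h with p ℕₚ.≟ p
    ...     | yes _   = h
    ...     | no  p≢p = contradiction ≡.refl p≢p

    kills : ∀ m → m ℕ.< suc n → dot (x₀ ∷ x) (λ i → A i m) ≈ 0#
    kills m m<1+n with m ℕₚ.≟ p
    ... | yes ≡.refl = kills-p
    ... | no  m≢p    = trans (+-comm _ _) (trans (sym (reduced m)) (A″≈0 m m≢p m<1+n))

  -- Weierstrass division

  monomial : ℕ → Carrier → Poly
  monomial zero    a = a ∷ []
  monomial (suc n) a = 0# ∷ monomial n a

  const-⋆ : ∀ a g → coeff (a ∷ []) ⋆ g ≋ a ⊙ g
  const-⋆ a g zero    = refl
  const-⋆ a g (suc n) = trans (+-congˡ (⋆-zeroˡ (φ g) (λ _ → refl) n)) (+-identityʳ _)

  0∷-⋆ : ∀ f g n → (coeff (0# ∷ f) ⋆ g) (suc n) ≈ (coeff f ⋆ φ g) n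
  0∷-⋆ f g n = trans (+-congʳ (zeroˡ _)) (+-identityˡ _)

  -- One quotient step of the division. Multiplication by τ^e moves the last minimising index of `r`
  -- from j to e + j, and `a` is `x` divided by the coefficient found there. As that coefficient
  -- attains the minimum, the product inherits the bound `N` everywhere, and beyond e + j it is
  -- better by δ.
  matching-multiple : ∀ {r y j V δ} → Lead r y j V δ → ∀ e x N → N ≤[ x ]⊞ weight (e ℕ.+ j) y →
    ∃[ a ] ((coeff (monomial e a) ⋆ r) (e ℕ.+ j) ≈ x ×
            Bound (coeff (monomial e a) ⋆ r) y N ×
            (∀ m → e ℕ.+ j ℕ.< m → N ℚ.+ δ ≤[ (coeff (monomial e a) ⋆ r) m ]⊞ weight m y))
  matching-multiple {r} {y} {j} {V} {δ} L zero x N hx with inverse _ (finite≉0 (ν-K L))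
  ... | z , rz≈1 with ν-finite {z} (λ z≈0 → 1≉0 (trans (sym rz≈1) (trans (*-congˡ z≈0) (zeroʳ _))))
  ...   | k , νz = x * z
    , trans (const-⋆ (x * z) r j) (trans (*-assoc _ _ _) (trans (*-congˡ (trans (*-comm _ _) rz≈1)) (*-identityʳ x)))
    , (λ m → bd-cong (sym (const-⋆ (x * z) r m)) (bd-* xz-bound (bound L m)))
    , (λ m j<m → bd-cong (sym (const-⋆ (x * z) r m)) (bd-* (bd-shift δ xz-bound) (gap L m j<m)))
    where
    val+k≡0 : val L ℤ.+ k ≡ + 0
    val+k≡0 = [-]-inj (≡.trans (≡.sym (ν-*-finite (ν-K L) νz)) (≡.trans (ν-cong rz≈1) ν-1))
    weight≡k+V : ⟦ k ⟧ ℚ.+ V ≡ weight j y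
    weight≡k+V = ≡.trans (≡.cong (⟦ k ⟧ ℚ.+_) (≡.sym (V≡ L)))
      (≡.trans (solve 3 (λ a b w → a :+ (b :+ w) := (b :+ a) :+ w) ≡.refl ⟦ k ⟧ ⟦ val L ⟧ (weight j y))
      (≡.trans (≡.cong (ℚ._+ weight j y) (≡.trans (≡.sym (⟦⟧-+ (val L) k)) (≡.trans (≡.cong ⟦_⟧ val+k≡0) ⟦0⟧)))
      (ℚₚ.+-identityˡ _)))
    xz-bound : N ≤[ x * z ]⊞ V
    xz-bound = bd-* hx (bd-attained νz (ℚₚ.≤-reflexive (≡.sym weight≡k+V)))
  matching-multiple {r} {y} {j} L (suc e) x N hx with matching-multiple (lead-φ L) e x N hx
  ... | a , hits , bnd , above = a
    , trans (0∷-⋆ (monomial e a) r (e ℕ.+ j)) hits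
    , (λ { zero    → bd-≈0 (zeroˡ _)
         ; (suc m) → bd-cong (sym (0∷-⋆ (monomial e a) r m)) (bnd m) })
    , (λ { (suc m) (ℕ.s≤s e+j<m) → bd-cong (sym (0∷-⋆ (monomial e a) r m)) (above m e+j<m) })

  module Weierstrass (r : Poly) {y j V δ} (L : Lead (coeff r) y j V δ) (u : Poly) where

    remainder : Poly → Series
    remainder t m = coeff u m + - (coeff t ⋆ coeff r) m

    remainder-+ : ∀ t s m → remainder (t +ₚ s) m ≈ remainder t m + - (coeff s ⋆ coeff r) m
    remainder-+ t s m = begin
      coeff u m + - (coeff (t +ₚ s) ⋆ coeff r) m
        ≈⟨ +-congˡ (-‿cong (trans (⋆-congʳ {g = coeff r} (coeff-+ t s) m) (⋆-distribʳ (coeff r) (coeff t) (coeff s) m))) ⟩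
      coeff u m + - ((coeff t ⋆ coeff r) m + (coeff s ⋆ coeff r) m)
        ≈⟨ +-congˡ (-‿+-comm _ _) ⟨
      coeff u m + (- (coeff t ⋆ coeff r) m + - (coeff s ⋆ coeff r) m)
        ≈⟨ +-assoc _ _ _ ⟨
      remainder t m + - (coeff s ⋆ coeff r) m ∎

    -- Coefficients below `j` are left free: they form the Weierstrass remainder. Those from `j` on
    -- are the error of the approximation.
    RemainderBound : ℚ → Poly → Set
    RemainderBound N t = ∀ m → j ℕ.≤ m → N ≤[ remainder t m ]⊞ weight m y

    -- Coefficients are cleared from e + j - 1 down to j. Clearing one disturbs those above by terms
    -- bounded by N + δ, so what has been gained there is kept; those below only need the bound `N`.
    eliminate : ∀ N e t → RemainderBound N t →
      (∀ m → e ℕ.+ j ℕ.≤ m → N ℚ.+ δ ≤[ remainder t m ]⊞ weight m y) → ∃[ t′ ] RemainderBound (N ℚ.+ δ) t′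
    eliminate N zero    t low high = t , high
    eliminate N (suc e) t low high
      with matching-multiple L e (remainder t (e ℕ.+ j)) N (low (e ℕ.+ j) (ℕₚ.m≤n+m j e))
    ... | a , hits , bnd , above = eliminate N e (t +ₚ s)
      (λ m j≤m → bd-cong (sym (remainder-+ t s m)) (bd-+ (low m j≤m) (bd-neg (bnd m)))) high′
      where
      s = monomial e a
      high′ : ∀ m → e ℕ.+ j ℕ.≤ m → N ℚ.+ δ ≤[ remainder (t +ₚ s) m ]⊞ weight m y
      high′ m e+j≤m with ℕₚ.m≤n⇒m<n∨m≡n e+j≤m
      ... | inj₁ e+j<m  = bd-cong (sym (remainder-+ t s m)) (bd-+ (high m e+j<m) (bd-neg (above m e+j<m)))
      ... | inj₂ ≡.refl = bd-≈0 (trans (remainder-+ t s m) (trans (+-congˡ (-‿cong hits)) (-‿inverseʳ _)))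

    improve : ∀ N t → RemainderBound N t → ∃[ t′ ] RemainderBound (N ℚ.+ δ) t′
    improve N t low = eliminate N e t low λ m e+j≤m → bd-≈0 (vanish m (ℕₚ.m+n≤o⇒m≤o e e+j≤m))
      where
      e : ℕ
      -- From this index on both polynomials vanish, so the elimination has a place to start.
      e = length u ℕ.⊔ length (t *ₚ r)
      vanish : ∀ m → e ℕ.≤ m → remainder t m ≈ 0#
      vanish m e≤m = trans (+-cong (coeff-beyond u (ℕₚ.m⊔n≤o⇒m≤o (length u) _ e≤m))
        (-‿cong (trans (sym (coeff-* t r m)) (coeff-beyond (t *ₚ r) (ℕₚ.m⊔n≤o⇒n≤o (length u) _ e≤m)))))
        (-‿inverseʳ 0#)

    approximate : ∀ {M} → Bound (coeff u) y M → ∀ n → ∃[ t ] RemainderBound (M ℚ.+ ⟦ + n ⟧ ℚ.* δ) t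
    approximate {M} hM zero = [] , λ m _ → bd-weaken (ℚₚ.≤-reflexive M+0≡M)
      (bd-cong (sym (trans (+-congˡ (trans (-‿cong (⋆-zeroˡ (coeff r) (λ _ → refl) m)) -0#≈0#)) (+-identityʳ _))) (hM m))
      where
      M+0≡M : M ℚ.+ ⟦ + 0 ⟧ ℚ.* δ ≡ M
      M+0≡M rewrite ⟦0⟧ = ≡.trans (≡.cong (M ℚ.+_) (ℚₚ.*-zeroˡ δ)) (ℚₚ.+-identityʳ M)
    approximate {M} hM (suc n) with approximate hM n
    ... | t , low with improve _ t low
    ...   | t′ , low′ = t′ , λ m j≤m → bd-weaken (ℚₚ.≤-reflexive step) (low′ m j≤m)
      where
      step : M ℚ.+ ⟦ + suc n ⟧ ℚ.* δ ≡ (M ℚ.+ ⟦ + n ⟧ ℚ.* δ) ℚ.+ δ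
      step rewrite fromℕ-suc n = solve 3 (λ m n d → m :+ (con 1ℚ :+ n) :* d := (m :+ n :* d) :+ d) ≡.refl M ⟦ + n ⟧ δ

    division : ∀ N → ∃[ t ] RemainderBound N t
    division N with bound-coeff u y
    ... | M , hM with archimedean (δ>0 L) (N ℚ.- M)
    ...   | n , N-M≤nδ with approximate hM n
    ...     | t , low = t , λ m j≤m → bd-weaken N≤ (low m j≤m)
      where
      N≤ : N ℚ.≤ M ℚ.+ ⟦ + n ⟧ ℚ.* δ
      N≤ = ≡.subst (ℚ._≤ M ℚ.+ ⟦ + n ⟧ ℚ.* δ) (solve 2 (λ m n → m :+ (n :- m) := n) ≡.refl M N)
        (ℚₚ.+-monoʳ-≤ M N-M≤nδ)

  -- Comparison of slopes

  τ^ : ℕ → Poly → Poly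
  τ^ zero    g = g
  τ^ (suc i) g = τ^ i (τ* g)

  combination : Poly → (ℕ → Poly) → Poly
  combination []      t = []
  combination (a ∷ x) t = List.map (a *_) (t 0) +ₚ combination x (t ∘ suc)

  coeff-combination : ∀ x t m → coeff (combination x t) m ≈ dot x (λ i → coeff (t i) m)
  coeff-combination []      t m = refl
  coeff-combination (a ∷ x) t m = trans (coeff-+ (List.map (a *_) (t 0)) (combination x (t ∘ suc)) m)
    (+-cong (coeff-⊙ a (t 0) m) (coeff-combination x (t ∘ suc) m))

  *-combination : ∀ x g → x *ₚ g ≡ combination x (λ i → τ^ i g)
  *-combination []      g = ≡.refl
  *-combination (a ∷ x) g = ≡.cong (List.map (a *_) g +ₚ_) (*-combination x (τ* g))

  combination-⋆ : ∀ x t r m → (coeff (combination x t) ⋆ r) m ≈ dot x (λ i → (coeff (t i) ⋆ r) m)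
  combination-⋆ []      t r m = ⋆-zeroˡ r (λ _ → refl) m
  combination-⋆ (a ∷ x) t r m = trans (⋆-congʳ {g = r} (coeff-+ (List.map (a *_) (t 0)) (combination x (t ∘ suc))) m)
    (trans (⋆-distribʳ r (coeff (List.map (a *_) (t 0))) (coeff (combination x (t ∘ suc))) m)
    (+-cong (trans (⋆-congʳ {g = r} (coeff-⊙ a (t 0)) m) (⋆-⊙ a (coeff (t 0)) r m)) (combination-⋆ x (t ∘ suc) r m)))

  dot-bound : ∀ x {u M W} → (∀ i → M ≤[ coeff x i * u i ]⊞ W) → M ≤[ dot x u ]⊞ W
  dot-bound []      h = bd-≈0 refl
  dot-bound (a ∷ x) h = bd-+ (h 0) (dot-bound x (h ∘ suc))

  one : Series
  one = coeff (1# ∷ [])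

  φ-one : φ one ≋ one
  φ-one zero    = 1^ q
  φ-one (suc n) = 0^q≈0 refl

  ⋆-identityʳ : ∀ f → f ⋆ one ≋ f
  ⋆-identityʳ f zero    = *-identityʳ _
  ⋆-identityʳ f (suc n) = trans (+-cong (zeroʳ _) (trans (⋆-congˡ {f ∘ suc} φ-one n) (⋆-identityʳ (f ∘ suc) n)))
    (+-identityˡ _)

  lead-product : ∀ {f g V w J K U δ δ′} → Lead f V J U δ → Lead g w K V δ′ →
    ∃[ δ″ ] Lead (f ⋆ g) w (J ℕ.+ K) U δ″
  lead-product {δ = δ} {δ′} Lf Lg = _ ,
    lead-⋆ (lead-δ 0<δ″ (ℚₚ.p⊓q≤p δ δ′) Lf) (lead-δ 0<δ″ (ℚₚ.p⊓q≤q δ δ′) Lg)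
    where
    0<δ″ : 0ℚ ℚ.< δ ℚ.⊓ δ′
    0<δ″ with ℚₚ.⊓-sel δ δ′
    ... | inj₁ eq = ≡.subst (0ℚ ℚ.<_) (≡.sym eq) (δ>0 Lf)
    ... | inj₂ eq = ≡.subst (0ℚ ℚ.<_) (≡.sym eq) (δ>0 Lg)

  bound≤lead : ∀ {f w K V δ M} → Lead f w K V δ → Bound f w M → M ℚ.≤ V
  bound≤lead {K = K} {M = M} L h = ≡.subst (M ℚ.≤_) (V≡ L) (_≤[_]⊞_.at (h K) (ν-K L))

  -- By the Gauss lemma a nonzero multiple s b attains its minimum at index J + K, where `x` has no
  -- coefficient left. There `e` must cancel s b, so s b satisfies the same bound as `e`, and then
  -- so does `x`.
  reduced-norm : ∀ {b w K m δ I M δ′} x → Lead b w K m δ → Lead (coeff x) w I M δ′ → length x ℕ.≤ K →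
    ∀ {e N} s → coeff x ≋ e ⊕ coeff s ⋆ b → Bound e w N → N ℚ.≤ M
  reduced-norm {b} {w} {K} {m} x Lb Lx |x|≤K {e} {N} s x≋e+sb he with lead? s m
  ... | inj₁ s≈0 = bound≤lead Lx λ n → bd-cong
    (sym (trans (x≋e+sb n) (trans (+-congˡ (⋆-zeroˡ b s≈0 n)) (+-identityʳ _)))) (he n)
  ... | inj₂ (J , U , δ″ , Ls) = bound≤lead Lx λ n → bd-cong (sym (x≋e+sb n))
    (bd-+ (he n) (bound-weaken N≤U (bound (proj₂ (lead-product Ls Lb))) n))
    where
    Lsb = proj₂ (lead-product Ls Lb)
    -e≈sb : - e (J ℕ.+ K) ≈ (coeff s ⋆ b) (J ℕ.+ K)
    -e≈sb = begin
      - e (J ℕ.+ K)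
        ≈⟨ +-identityʳ _ ⟨
      - e (J ℕ.+ K) + 0#
        ≈⟨ +-congˡ (trans (sym (x≋e+sb (J ℕ.+ K))) (coeff-beyond x (ℕₚ.≤-trans |x|≤K (ℕₚ.m≤n+m K J)))) ⟨
      - e (J ℕ.+ K) + (e (J ℕ.+ K) + (coeff s ⋆ b) (J ℕ.+ K))
        ≈⟨ +-assoc _ _ _ ⟨
      (- e (J ℕ.+ K) + e (J ℕ.+ K)) + (coeff s ⋆ b) (J ℕ.+ K)
        ≈⟨ +-congʳ (-‿inverseˡ _) ⟩
      0# + (coeff s ⋆ b) (J ℕ.+ K)
        ≈⟨ +-identityˡ _ ⟩
      (coeff s ⋆ b) (J ℕ.+ K) ∎
    N≤U : N ℚ.≤ U
    N≤U = ≡.subst (N ℚ.≤_) (V≡ Lsb) (_≤[_]⊞_.at (bd-cong -e≈sb (bd-neg (he (J ℕ.+ K)))) (ν-K Lsb))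

  record CoprimeMultiple (a b r s : Poly) : Set (c ⊔ ℓ) where
    field
      α β    : Poly
      bézout : one ≋ coeff α ⋆ coeff a ⊕ coeff β ⋆ coeff b
      common : coeff r ⋆ coeff a ≋ coeff s ⋆ coeff b

  slope-≤ : ∀ {a b r s w y j V δ k m δ′} → CoprimeMultiple a b r s → Bound (coeff a) w y →
    Lead (coeff r) y j V δ → Lead (coeff b) w k m δ′ → k ℕ.≤ j
  slope-≤ {a} {b} {r} {s} {w} {y} {j} {V} {δ} {k} {m} ab ha Lr Lb = ℕₚ.≮⇒≥ impossible
    where
    open CoprimeMultiple ab
    module W i = Weierstrass r Lr (τ^ i α)
    -- τⁱ α is approximated by t i · r, up to terms of degree below j.
    t : ℕ → Poly
    t i = proj₁ (W.division i (weight i w ℚ.+ 1ℚ))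
    e : ℕ → Series
    e i = W.remainder i (t i)
    impossible : ¬ (j ℕ.< k)
    -- Division does not control the coefficients of `e i` below `j`. Making them cancel is a system
    -- of j equations in the j + 1 unknown coefficients of `x`.
    impossible j<k with dependence j e
    ... | x , |x|≤1+j , (_ , xᵢ≉0) , x·e≈0 with lead-of x w xᵢ≉0
    ...   | I , M , _ , Lx = <⇒≱ (p<p+δ (ℚₚ.positive⁻¹ 1ℚ))
      (reduced-norm x Lb Lx (ℕₚ.≤-trans |x|≤1+j j<k) S x≋ (bound-⋆ {E} {coeff a} E-bound ha))
      where
      E : Series
      E m = dot x (λ i → e i m)
      T = combination x t
      S = T *ₚ s +ₚ x *ₚ β
      -- As ν(xᵢ) + qⁱ w ≥ M for all i, the precision `weight i w` + 1 demanded of `e i` gains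
      -- exactly 1 over the norm of `x`, uniformly in i.
      E-bound : Bound E y (M ℚ.+ 1ℚ)
      E-bound m with j ℕₚ.≤? m
      ... | yes j≤m = dot-bound x λ i →
        bd-* (bd-shift 1ℚ (bound Lx i)) (proj₂ (W.division i (weight i w ℚ.+ 1ℚ)) m j≤m)
      ... | no  j≰m = bd-≈0 (x·e≈0 m (ℕₚ.≰⇒> j≰m))
      xα≋ : coeff x ⋆ coeff α ≋ E ⊕ coeff T ⋆ coeff r
      xα≋ m = begin
        (coeff x ⋆ coeff α) m
          ≈⟨ coeff-* x α m ⟨
        coeff (x *ₚ α) m
          ≡⟨ ≡.cong (λ p → coeff p m) (*-combination x α) ⟩
        coeff (combination x (λ i → τ^ i α)) m
          ≈⟨ coeff-combination x (λ i → τ^ i α) m ⟩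
        dot x (λ i → coeff (τ^ i α) m)
          ≈⟨ dot-cong x (λ i → split (coeff (τ^ i α) m) ((coeff (t i) ⋆ coeff r) m)) ⟩
        dot x (λ i → e i m + (coeff (t i) ⋆ coeff r) m)
          ≈⟨ dot-+ x (λ i → e i m) (λ i → (coeff (t i) ⋆ coeff r) m) ⟩
        E m + dot x (λ i → (coeff (t i) ⋆ coeff r) m)
          ≈⟨ +-congˡ (combination-⋆ x t (coeff r) m) ⟨
        E m + (coeff T ⋆ coeff r) m ∎
        where
        split : ∀ p q → p ≈ (p + - q) + q
        split p q = sym (trans (+-assoc _ _ _) (trans (+-congˡ (-‿inverseˡ q)) (+-identityʳ p)))
      Tra≋ : (coeff T ⋆ coeff r) ⋆ coeff a ≋ coeff (T *ₚ s) ⋆ coeff b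
      Tra≋ = ≋-trans (⋆-assoc (coeff T) (coeff r) (coeff a))
        (≋-trans (⋆-congˡ {coeff T} common)
        (≋-trans (≋-sym (⋆-assoc (coeff T) (coeff s) (coeff b)))
          (⋆-congʳ {g = coeff b} (≋-sym (coeff-* T s)))))
      x≋ : coeff x ≋ E ⋆ coeff a ⊕ coeff S ⋆ coeff b
      x≋ m = begin
        coeff x m
          ≈⟨ ⋆-identityʳ (coeff x) m ⟨
        (coeff x ⋆ one) m
          ≈⟨ ⋆-congˡ {coeff x} bézout m ⟩
        (coeff x ⋆ (coeff α ⋆ coeff a ⊕ coeff β ⋆ coeff b)) m
          ≈⟨ ⋆-distribˡ (coeff x) (coeff α ⋆ coeff a) (coeff β ⋆ coeff b) m ⟩
        (coeff x ⋆ (coeff α ⋆ coeff a)) m + (coeff x ⋆ (coeff β ⋆ coeff b)) m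
          ≈⟨ +-cong (⋆-assoc (coeff x) (coeff α) (coeff a) m) (⋆-assoc (coeff x) (coeff β) (coeff b) m) ⟨
        ((coeff x ⋆ coeff α) ⋆ coeff a) m + ((coeff x ⋆ coeff β) ⋆ coeff b) m
          ≈⟨ +-cong (⋆-congʳ {g = coeff a} xα≋ m) (⋆-congʳ {g = coeff b} (≋-sym (coeff-* x β)) m) ⟩
        ((E ⊕ coeff T ⋆ coeff r) ⋆ coeff a) m + (coeff (x *ₚ β) ⋆ coeff b) m
          ≈⟨ +-congʳ (⋆-distribʳ (coeff a) E (coeff T ⋆ coeff r) m) ⟩
        (E ⋆ coeff a) m + ((coeff T ⋆ coeff r) ⋆ coeff a) m + (coeff (x *ₚ β) ⋆ coeff b) m
          ≈⟨ +-congʳ (+-congˡ (Tra≋ m)) ⟩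
        (E ⋆ coeff a) m + (coeff (T *ₚ s) ⋆ coeff b) m + (coeff (x *ₚ β) ⋆ coeff b) m
          ≈⟨ +-assoc _ _ _ ⟩
        (E ⋆ coeff a) m + ((coeff (T *ₚ s) ⋆ coeff b) m + (coeff (x *ₚ β) ⋆ coeff b) m)
          ≈⟨ +-congˡ (⋆-distribʳ (coeff b) (coeff (T *ₚ s)) (coeff (x *ₚ β)) m) ⟨
        (E ⋆ coeff a) m + ((coeff (T *ₚ s) ⊕ coeff (x *ₚ β)) ⋆ coeff b) m
          ≈⟨ +-congˡ (⋆-congʳ {g = coeff b} (coeff-+ (T *ₚ s) (x *ₚ β)) m) ⟨
        (E ⋆ coeff a) m + (coeff S ⋆ coeff b) m ∎

  -- Breakpoints, and descent along the slopes of V_b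

  open _≤[_]⊞_

  Q : ℕ → ℚ
  Q n = ⟦ + (q ℕ.^ n) ⟧

  private instance
    q≢0 : ℕ.NonZero q
    q≢0 = ℕ.>-nonZero (ℕₚ.<-trans (ℕ.s≤s ℕ.z≤n) 1<q)

  Q-mono-≤ : ∀ {i j} → i ℕ.≤ j → Q i ℚ.≤ Q j
  Q-mono-≤ i≤j = fromℕ-mono-≤ (ℕₚ.^-monoʳ-≤ q i≤j)

  Q-mono-< : ∀ {i j} → i ℕ.< j → Q i ℚ.< Q j
  Q-mono-< i<j = fromℕ-mono-< (ℕₚ.^-monoʳ-< q 1<q i<j)

  1≤Q : ∀ n → 1ℚ ℚ.≤ Q n
  1≤Q n = ≡.subst (ℚ._≤ Q n) ⟦1⟧ (Q-mono-≤ (ℕ.z≤n {n}))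

  line : ℤ → ℕ → ℚ → ℚ
  line k n x = ⟦ k ⟧ ℚ.+ Q n ℚ.* x

  line≡ : ∀ k n x → ⟦ k ⟧ ℚ.+ weight n x ≡ line k n x
  line≡ k n x = ≡.cong (⟦ k ⟧ ℚ.+_) (weight≡ n x)

  at-line : ∀ {M b k} n x → M ≤[ b ]⊞ weight n x → ν b ≡ [ k ] → M ℚ.≤ line k n x
  at-line {M} {k = k} n x h eq = ≡.subst (M ℚ.≤_) (line≡ k n x) (at h eq)

  bd-line : ∀ {M b} n x → (∀ {k} → ν b ≡ [ k ] → M ℚ.≤ line k n x) → M ≤[ b ]⊞ weight n x
  bd-line {M} n x h .at {k} eq = ≡.subst (M ℚ.≤_) (≡.sym (line≡ k n x)) (h eq)

  -- The steeper line falls faster to the left, so an order in which it lies below persists there;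
  -- `line-right` is the mirror image.
  line-left : ∀ {b k x x′} n i → i ℕ.≤ n → x′ ℚ.≤ x →
    line k n x ≤[ b ]⊞ weight i x → line k n x′ ≤[ b ]⊞ weight i x′
  line-left {k = k} {x} {x′} n i i≤n x′≤x h = bd-line i x′ λ {k′} eq →
    line-≤ {Q n} {Q i} ⟦ k ⟧ ⟦ k′ ⟧
      (≡.subst (0ℚ ℚ.≤_) (solve 4 (λ a b x y → (a :- b) :* (x :- y) := (b :- a) :* (y :- x)) ≡.refl (Q n) (Q i) x x′)
        (0≤p*q (0≤q-p (Q-mono-≤ i≤n)) (0≤q-p x′≤x)))
      (at-line i x h eq)

  line-right : ∀ {b k x x′} n i → n ℕ.≤ i → x ℚ.≤ x′ →
    line k n x ≤[ b ]⊞ weight i x → line k n x′ ≤[ b ]⊞ weight i x′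
  line-right {k = k} {x} {x′} n i n≤i x≤x′ h = bd-line i x′ λ {k′} eq →
    line-≤ {Q n} {Q i} ⟦ k ⟧ ⟦ k′ ⟧ (0≤p*q (0≤q-p (Q-mono-≤ n≤i)) (0≤q-p x≤x′)) (at-line i x h eq)

  -- A point w′ ≥ w up to which the line of index n stays below those of index ≤ m, and where it meets one of them.
  record Breakpoint (b : Series) (w : ℚ) (k : ℤ) (n m : ℕ) : Set where
    field
      w′     : ℚ
      w≤w′   : w ℚ.≤ w′
      i      : ℕ
      i≤m    : i ℕ.≤ m
      k′     : ℤ
      ν-i    : ν (b i) ≡ [ k′ ]
      meets  : line k n w′ ≡ line k′ i w′
      below  : ∀ {j} → j ℕ.≤ m → line k n w′ ≤[ b j ]⊞ weight j w′

  line-crossing : ∀ k n k′ i w → i ℕ.< n → line k n w ℚ.≤ line k′ i w →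
    ∃[ x ] (w ℚ.≤ x × line k n x ≡ line k′ i x × (∀ x′ → line k′ i x′ ℚ.≤ line k n x′ → x ℚ.≤ x′))
  line-crossing k n k′ i w i<n = crossing {Q n} {Q i} ⟦ k ⟧ ⟦ k′ ⟧ w (Q-mono-< i<n)

  bd-meets : ∀ {b} k n k′ i x → ν b ≡ [ k′ ] → line k n x ≡ line k′ i x → line k n x ≤[ b ]⊞ weight i x
  bd-meets k n k′ i x eq meets =
    bd-attained eq (ℚₚ.≤-reflexive (≡.trans meets (≡.sym (line≡ k′ i x))))

  -- The line of index 0 is present because b₀ ≠ 0 and gives a first crossing. Each further line
  -- either lies above at the current point or pulls that point back to its own crossing, which
  -- preserves the inequalities already obtained.
  breakpoint : ∀ {b w k n} m → m ℕ.< n → ¬ b 0 ≈ 0# → Bound b w (line k n w) → Breakpoint b w k n m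
  breakpoint {b} {w} {k} {n} zero 0<n b₀≉0 h = first (ν-finite b₀≉0)
    where
    first : ∃[ k₀ ] (ν (b 0) ≡ [ k₀ ]) → Breakpoint b w k n 0
    first (k₀ , ν₀) = record
      { w′ = proj₁ X ; w≤w′ = proj₁ (proj₂ X) ; i = 0 ; i≤m = ℕ.z≤n ; k′ = k₀ ; ν-i = ν₀
      ; meets = proj₁ (proj₂ (proj₂ X))
      ; below = λ { ℕ.z≤n → bd-meets k n k₀ 0 (proj₁ X) ν₀ (proj₁ (proj₂ (proj₂ X))) } }
      where X = line-crossing k n k₀ 0 w 0<n (at-line 0 w (h 0) ν₀)
  breakpoint {b} {w} {k} {n} (suc m) 1+m<n b₀≉0 h =
    step (breakpoint {b} {w} {k} {n} m (ℕₚ.<-trans (ℕₚ.n<1+n m) 1+m<n) b₀≉0 h) (view (b (suc m)))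
    where
    split : ∀ {x} → line k n x ≤[ b (suc m) ]⊞ weight (suc m) x →
      (∀ {j} → j ℕ.≤ m → line k n x ≤[ b j ]⊞ weight j x) →
      ∀ {j} → j ℕ.≤ suc m → line k n x ≤[ b j ]⊞ weight j x
    split hₘ below j≤ with ℕₚ.m≤n⇒m<n∨m≡n j≤
    ... | inj₁ j<     = below (ℕ.s≤s⁻¹ j<)
    ... | inj₂ ≡.refl = hₘ
    step : Breakpoint b w k n m → View (b (suc m)) → Breakpoint b w k n (suc m)
    step P = compare
      where
      open Breakpoint P
      keep : line k n w′ ≤[ b (suc m) ]⊞ weight (suc m) w′ → Breakpoint b w k n (suc m)
      keep hₘ = record
        { w′ = w′ ; w≤w′ = w≤w′ ; i = i ; i≤m = ℕₚ.m≤n⇒m≤1+n i≤m ; k′ = k′ ; ν-i = ν-i ; meets = meets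
        ; below = split hₘ below }
      move : ∀ kₘ → ν (b (suc m)) ≡ [ kₘ ] → line kₘ (suc m) w′ ℚ.≤ line k n w′ → Breakpoint b w k n (suc m)
      move kₘ νₘ h≤ = record
        { w′ = proj₁ X ; w≤w′ = proj₁ (proj₂ X) ; i = suc m ; i≤m = ℕₚ.≤-refl ; k′ = kₘ ; ν-i = νₘ
        ; meets = proj₁ (proj₂ (proj₂ X))
        ; below = split (bd-meets k n kₘ (suc m) (proj₁ X) νₘ (proj₁ (proj₂ (proj₂ X)))) λ {j} j≤m →
            line-left n j (ℕₚ.≤-trans j≤m (ℕₚ.≤-trans (ℕₚ.n≤1+n m) (ℕₚ.<⇒≤ 1+m<n)))
              (proj₂ (proj₂ (proj₂ X)) w′ h≤) (below j≤m) }
        where X = line-crossing k n kₘ (suc m) w 1+m<n (at-line (suc m) w (h (suc m)) νₘ)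
      compare : View (b (suc m)) → Breakpoint b w k n (suc m)
      compare (isZero bₘ≈0) = keep (bd-≈0 bₘ≈0)
      compare (hasVal kₘ νₘ) with ℚₚ.≤-total (line k n w′) (line kₘ (suc m) w′)
      ... | inj₁ h≤ = keep (bd-attained νₘ (≡.subst (line k n w′ ℚ.≤_) (≡.sym (line≡ kₘ (suc m) w′)) h≤))
      ... | inj₂ h≥ = move kₘ νₘ h≥

  -- The slopes of V_a are powers of q, hence at least 1. The line that attains the minimum at `w′`
  -- also lies above `y` at `w`, so comparing along this one line suffices.
  lead-growth : ∀ {a w w′ I I′ y y′ δ δ′} → Lead a w I y δ → Lead a w′ I′ y′ δ′ → w ℚ.≤ w′ → w′ ℚ.- w ℚ.≤ y′ ℚ.- y
  lead-growth {a} {w} {w′} {I} {I′} {y} {y′} L L′ w≤w′ = ≤-from-0≤ _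
    (ℚₚ.+-mono-≤ (0≤q-p y≤) (0≤p*q (0≤q-p (1≤Q I′)) (0≤q-p w≤w′)))
    (≡.trans (solve 5 (λ k Q y w w′ → (w′ :- w) :+ (((k :+ Q :* w) :- y) :+ (Q :- con 1ℚ) :* (w′ :- w)) := (k :+ Q :* w′) :- y)
        ≡.refl ⟦ val L′ ⟧ (Q I′) y w w′)
      (≡.cong (ℚ._- y) (≡.trans (≡.sym (line≡ (val L′) I′ w′)) (V≡ L′))))
    where
    y≤ : y ℚ.≤ line (val L′) I′ w
    y≤ = at-line I′ w (bound L I′) (ν-K L′)

  lead-last : ∀ {b w K m δ k n} → Lead b w K m δ → ν (b n) ≡ [ k ] → Bound b w (line k n w) → n ℕ.≤ K
  lead-last {b} {w} {K} {m} {δ} {k} {n} L eq h = ℕₚ.≮⇒≥ λ K<n →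
    <⇒≱ (p<p+δ (δ>0 L)) (ℚₚ.≤-trans (at-line n w (gap L n K<n) eq) (bound≤lead L h))

  -- Induction on an index n at which V_b(w) is attained: at the next breakpoint to the right a smaller one is.
  descent : ∀ {a b r s} → CoprimeMultiple a b r s → ¬ coeff a 0 ≈ 0# → coeff b 0 ≈ 1# → coeff r 0 ≈ 1# →
    ∀ N n → n ℕ.≤ N → ∀ {w k I y δ U} → ν (coeff b n) ≡ [ k ] → Bound (coeff b) w (line k n w) →
    Lead (coeff a) w I y δ → Bound (coeff r) y U → U ℚ.+ w ℚ.≤ line k n w ℚ.+ y
  descent {a} {b} {r} {s} ab a₀≉0 b₀≈1 r₀≈1 _ zero _ {w} {k} {y = y} {U = U} ν₀ hb La hr =
    -- Index 0 attains the minimum and b₀ = 1, so V_b(w) = w; and r₀ = 1 gives U ≤ y.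
    ℚₚ.≤-trans (ℚₚ.+-mono-≤ (at (hr 0) (≡.trans (ν-cong r₀≈1) ν-1)) ℚₚ.≤-refl) (ℚₚ.≤-reflexive eq)
    where
    k≡0 : k ≡ + 0
    k≡0 = [-]-inj (≡.trans (≡.sym ν₀) (≡.trans (ν-cong b₀≈1) ν-1))
    eq : ⟦ + 0 ⟧ ℚ.+ y ℚ.+ w ≡ line k 0 w ℚ.+ y
    eq rewrite k≡0 | ⟦1⟧ = solve 3 (λ z y w → z :+ y :+ w := (z :+ con 1ℚ :* w) :+ y) ≡.refl ⟦ + 0 ⟧ y w
  descent {a} {b} {r} {s} ab a₀≉0 b₀≈1 r₀≈1 (suc N) (suc n) (ℕ.s≤s n≤N) {w} {k} {I} {y} {δ} {U} νₙ hb La hr =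
    descent-step {Q J} {Q (suc n)} {U} {⟦ val Lr ⟧} {⟦ k ⟧} (1≤Q (suc n)) (Q-mono-≤ 1+n≤J) w≤w′
      (lead-growth La La′ w≤w′) (at-line J y (hr J) (ν-K Lr)) previous
    where
    open Breakpoint (breakpoint {coeff b} {w} {k} {suc n} n (ℕₚ.n<1+n n)
      (λ b₀≈0 → 1≉0 (trans (sym b₀≈1) b₀≈0)) hb)
    -- Index n + 1 still attains the minimum at `w′`: the breakpoint takes care of the smaller
    -- indices, and the lines of larger index are steeper and stay above to the right.
    hb′ : Bound (coeff b) w′ (line k (suc n) w′)
    hb′ j with ℕₚ.<-cmp j (suc n)
    ... | tri< j<1+n _ _ = below (ℕ.s≤s⁻¹ j<1+n)
    ... | tri≈ _ j≡1+n _ = line-right (suc n) j (ℕₚ.≤-reflexive (≡.sym j≡1+n)) w≤w′ (hb j)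
    ... | tri> _ _ 1+n<j = line-right (suc n) j (ℕₚ.<⇒≤ 1+n<j) w≤w′ (hb j)
    leadA = lead-of a w′ {0} a₀≉0
    La′ = proj₂ (proj₂ (proj₂ leadA))
    y′ = proj₁ (proj₂ leadA)
    leadB = lead-of b w′ {0} (λ b₀≈0 → 1≉0 (trans (sym b₀≈1) b₀≈0))
    Lb = proj₂ (proj₂ (proj₂ leadB))
    leadR = lead-of r y′ {0} (λ r₀≈0 → 1≉0 (trans (sym r₀≈1) r₀≈0))
    Lr = proj₂ (proj₂ (proj₂ leadR))
    J = proj₁ leadR
    -- Attaining V_b at `w′`, the index n + 1 is at most the last one that does, and `slope-≤`
    -- bounds the latter by the last index for `r` at `y′`.
    1+n≤J : suc n ℕ.≤ J
    1+n≤J = ℕₚ.≤-trans (lead-last Lb νₙ hb′) (slope-≤ ab (bound La′) Lr Lb)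
    previous : line (val Lr) J y′ ℚ.+ w′ ℚ.≤ line k (suc n) w′ ℚ.+ y′
    previous = ≡.subst₂ (λ V m → V ℚ.+ w′ ℚ.≤ m ℚ.+ y′) (≡.trans (≡.sym (V≡ Lr)) (line≡ (val Lr) J y′)) (≡.sym meets)
      (descent ab a₀≉0 b₀≈1 r₀≈1 N i (ℕₚ.≤-trans i≤m n≤N) ν-i (≡.subst (Bound (coeff b) w′) meets hb′) La′ (bound Lr))

  -- V as a minimum taken term by term along Cauchy sequences

  -- V with arbitrary weights E i in place of qⁱ z, as needed for induction on f.
  V^ : (ℕ → ℝ) → Poly → ℝ ⁺
  V^ E f = foldr _⊓ℝ∞_ ⊤⁺ (tabulate {n = length f} λ i → fromℤ∞ (ν (lookup f i)) +ℝ∞ [ E (toℕ i) ])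

  BoundAt : (ℕ → ℝ) → Poly → ℕ → ℚ → Set
  BoundAt E f n M = ∀ i → M ≤[ coeff f i ]⊞ seq (E i) n

  -- The minimum is described by its universal property at each term of the sequences, since the
  -- operations on ℝ act termwise. The `Lift` brings this clause to the universe of the clause for
  -- ∞.
  IsMinimum : (ℕ → ℝ) → Poly → ℝ ⁺ → Set ℓ
  IsMinimum E f ⊤⁺    = ∀ i → coeff f i ≈ 0#
  IsMinimum E f [ x ] = ∀ n → Lift ℓ (BoundAt E f n (seq x n) × (∀ M → BoundAt E f n M → M ℚ.≤ seq x n))

  isMinimum-∷ : ∀ E a f s → ν a ≡ s → ∀ t → IsMinimum (E ∘ suc) f t →
    IsMinimum E (a ∷ f) ((fromℤ∞ s +ℝ∞ [ E 0 ]) ⊓ℝ∞ t)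
  isMinimum-∷ E a f ⊤⁺ eq ⊤⁺ h zero    = Equivalence.to (ν≡∞⇔≈0 a) eq
  isMinimum-∷ E a f ⊤⁺ eq ⊤⁺ h (suc i) = h i
  isMinimum-∷ E a f ⊤⁺ eq [ x ] h n = lift (bound′ , λ M b → proj₂ (lower (h n)) M (b ∘ suc))
    where
    bound′ : BoundAt E (a ∷ f) n (seq x n)
    bound′ zero    = bd-≈0 (Equivalence.to (ν≡∞⇔≈0 a) eq)
    bound′ (suc i) = proj₁ (lower (h n)) i
  isMinimum-∷ E a f [ k ] eq t h = go t h
    where
    W : ℕ → ℚ
    W n = seq (E 0) n
    to/1 : ∀ {M} n → M ≤[ a ]⊞ W n → M ℚ.≤ k / 1 ℚ.+ W n
    to/1 {M} n b = ≡.subst (λ r → M ℚ.≤ r ℚ.+ W n) (⟦⟧≡/1 k) (at b eq)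
    from/1 : ∀ {M} n → M ℚ.≤ k / 1 ℚ.+ W n → M ≤[ a ]⊞ W n
    from/1 {M} n h = bd-attained eq (≡.subst (λ r → M ℚ.≤ r ℚ.+ W n) (≡.sym (⟦⟧≡/1 k)) h)
    go : ∀ t → IsMinimum (E ∘ suc) f t → IsMinimum E (a ∷ f) ((fromℤ∞ [ k ] +ℝ∞ [ E 0 ]) ⊓ℝ∞ t)
    go ⊤⁺ f≈0 n = lift (bound′ , λ M b → to/1 n (b 0))
      where
      bound′ : BoundAt E (a ∷ f) n (k / 1 ℚ.+ W n)
      bound′ zero    = from/1 n ℚₚ.≤-refl
      bound′ (suc i) = bd-≈0 (f≈0 i)
    go [ x ] h n = lift (bound′ , λ M b → ℚₚ.⊓-glb (to/1 n (b 0)) (proj₂ (lower (h n)) M (b ∘ suc)))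
      where
      bound′ : BoundAt E (a ∷ f) n ((k / 1 ℚ.+ W n) ℚ.⊓ seq x n)
      bound′ zero    = from/1 n (ℚₚ.p⊓q≤p (k / 1 ℚ.+ W n) (seq x n))
      bound′ (suc i) = bd-weaken (ℚₚ.p⊓q≤q (k / 1 ℚ.+ W n) (seq x n)) (proj₁ (lower (h n)) i)

  isMinimum-V^ : ∀ E f → IsMinimum E f (V^ E f)
  isMinimum-V^ E []      = λ _ → refl
  isMinimum-V^ E (a ∷ f) = isMinimum-∷ E a f (ν a) ≡.refl _ (isMinimum-V^ (E ∘ suc) f)

  module _ (z : ℝ) where

    Value : Poly → Set
    Value f = ∃[ x ] (V v f z ≡ [ x ] × (∀ n → Bound (coeff f) (seq z n) (seq x n)) ×
      (∀ n M → Bound (coeff f) (seq z n) M → M ℚ.≤ seq x n))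

    value : ∀ f → coeff f 0 ≈ 1# → Value f
    value f f₀≈1 = go weights (λ n i → ≡.trans (seq-· (q ℕ.^ i) z n) (≡.sym (weight≡ i (seq z n))))
        (V v f z) ≡.refl (isMinimum-V^ weights f)
      where
      weights : ℕ → ℝ
      weights i = (q ℕ.^ i) · z
      go : ∀ E → (∀ n i → seq (E i) n ≡ weight i (seq z n)) → ∀ t → V v f z ≡ t → IsMinimum E f t → Value f
      go E E≡ ⊤⁺    _  f≈0 = contradiction (trans (sym f₀≈1) (f≈0 0)) 1≉0
      go E E≡ [ x ] eq h   = x , eq
        , (λ n i → ≡.subst (seq x n ≤[ coeff f i ]⊞_) (E≡ n i) (proj₁ (lower (h n)) i))
        , (λ n M b → proj₂ (lower (h n)) M λ i → ≡.subst (M ≤[ coeff f i ]⊞_) (≡.sym (E≡ n i)) (b i))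

  -- Division by the greatest common divisor

  module _ {f g d l : Poly} (f₀≈1 : IsNormalized f) (g₀≈1 : IsNormalized g)
    (gcd : IsNormalizedGCD f g d) (lcm : IsNormalizedLCM f g l) where

    d₀≈1 : coeff d 0 ≈ 1#
    d₀≈1 = proj₁ gcd

    l₀≈1 : coeff l 0 ≈ 1#
    l₀≈1 = proj₁ lcm

    generator∈ : ∀ p → ⟨ p ⟩ p
    generator∈ p = 1# ∷ [] , ≋-sym (≋-trans (coeff-* (1# ∷ []) p) (⋆-identityˡ (coeff p)))

    +ₚ-identityʳ : ∀ p → p +ₚ [] ≡ p
    +ₚ-identityʳ []      = ≡.refl
    +ₚ-identityʳ (x ∷ p) = ≡.refl

    f∈⟨d⟩ : ⟨ d ⟩ f
    f∈⟨d⟩ = proj₂ (proj₂ gcd) {f} (f , [] , generator∈ f , ([] , λ _ → refl) ,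
      λ n → reflexive (≡.cong (λ p → coeff p n) (≡.sym (+ₚ-identityʳ f))))

    g∈⟨d⟩ : ⟨ d ⟩ g
    g∈⟨d⟩ = proj₂ (proj₂ gcd) {g} ([] , g , ([] , λ _ → refl) , generator∈ g , λ _ → refl)

    factor : ∀ p h (h∈ : ⟨ p ⟩ h) → coeff h ≋ coeff (proj₁ h∈) ⋆ coeff p
    factor p h (a , h≈ap) = ≋-trans h≈ap (coeff-* a p)

    a = proj₁ f∈⟨d⟩
    b = proj₁ g∈⟨d⟩
    f≋ad = factor d f f∈⟨d⟩
    g≋bd = factor d g g∈⟨d⟩

    d∈ : (⟨ f ⟩ +ᴵ ⟨ g ⟩) d
    d∈ = proj₁ (proj₂ gcd) {d} (generator∈ d)

    l∈ : ⟨ f ⟩ l × ⟨ g ⟩ l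
    l∈ = proj₁ (proj₂ lcm) {l} (generator∈ l)

    r = proj₁ (proj₁ l∈)
    s = proj₁ (proj₂ l∈)

    normalized-quotient : ∀ p e h → coeff p 0 ≈ 1# → coeff h 0 ≈ 1# → coeff h ≋ coeff e ⋆ coeff p → coeff e 0 ≈ 1#
    normalized-quotient p e h p₀≈1 h₀≈1 h≋ep = trans (sym (trans (*-congˡ p₀≈1) (*-identityʳ _))) (trans (sym (h≋ep 0)) h₀≈1)

    l≋rad : coeff l ≋ (coeff r ⋆ coeff a) ⋆ coeff d
    l≋rad = ≋-trans (factor f l (proj₁ l∈)) (≋-trans (⋆-congˡ {coeff r} f≋ad) (≋-sym (⋆-assoc (coeff r) (coeff a) (coeff d))))

    l≋sbd : coeff l ≋ (coeff s ⋆ coeff b) ⋆ coeff d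
    l≋sbd = ≋-trans (factor g l (proj₂ l∈)) (≋-trans (⋆-congˡ {coeff s} g≋bd) (≋-sym (⋆-assoc (coeff s) (coeff b) (coeff d))))

    -- Right multiplication by `d` is injective because d₀ = 1, so both relations may be checked
    -- after multiplying by `d`.
    coprime : CoprimeMultiple a b r s
    coprime = record
      { α = α ; β = β
      ; bézout = ⋆-cancelʳ {d = coeff d} d₀≈1 one⋆d≋
      ; common = ⋆-cancelʳ {d = coeff d} d₀≈1 (≋-trans (≋-sym l≋rad) l≋sbd) }
      where
      u = proj₁ d∈
      u′ = proj₁ (proj₂ d∈)
      u∈ = proj₁ (proj₂ (proj₂ d∈))
      u′∈ = proj₁ (proj₂ (proj₂ (proj₂ d∈)))
      d≈u+u′ = proj₂ (proj₂ (proj₂ (proj₂ d∈)))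
      α = proj₁ u∈
      β = proj₁ u′∈
      one⋆d≋ : one ⋆ coeff d ≋ (coeff α ⋆ coeff a ⊕ coeff β ⋆ coeff b) ⋆ coeff d
      one⋆d≋ n = begin
        (one ⋆ coeff d) n
          ≈⟨ ⋆-identityˡ (coeff d) n ⟩
        coeff d n
          ≈⟨ trans (d≈u+u′ n) (coeff-+ u u′ n) ⟩
        coeff u n + coeff u′ n
          ≈⟨ +-cong (factor f u u∈ n) (factor g u′ u′∈ n) ⟩
        (coeff α ⋆ coeff f) n + (coeff β ⋆ coeff g) n
          ≈⟨ +-cong (⋆-congˡ {coeff α} f≋ad n) (⋆-congˡ {coeff β} g≋bd n) ⟩
        (coeff α ⋆ (coeff a ⋆ coeff d)) n + (coeff β ⋆ (coeff b ⋆ coeff d)) n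
          ≈⟨ +-cong (⋆-assoc (coeff α) (coeff a) (coeff d) n) (⋆-assoc (coeff β) (coeff b) (coeff d) n) ⟨
        ((coeff α ⋆ coeff a) ⋆ coeff d) n + ((coeff β ⋆ coeff b) ⋆ coeff d) n
          ≈⟨ ⋆-distribʳ (coeff d) (coeff α ⋆ coeff a) (coeff β ⋆ coeff b) n ⟨
        ((coeff α ⋆ coeff a ⊕ coeff β ⋆ coeff b) ⋆ coeff d) n ∎

    -- With w = V_d(x), y = V_a(w), m = V_b(w) and U = V_r(y), the Gauss lemma gives D ≤ w, L ≤ U, y
    -- ≤ A and m ≤ B. What remains is U + w ≤ m + y, the outcome of the descent.
    norm-inequality : ∀ x {D L A B} → Bound (coeff d) x D → Bound (coeff l) x L →
      (∀ M → Bound (coeff f) x M → M ℚ.≤ A) → (∀ M → Bound (coeff g) x M → M ℚ.≤ B) →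
      D ℚ.+ L ℚ.≤ A ℚ.+ B
    norm-inequality x {D} {L} {A} {B} hd hl hf hg =
      ℚₚ.≤-trans (ℚₚ.+-mono-≤ (bound≤lead Ld hd) L≤U)
      (ℚₚ.≤-trans (ℚₚ.≤-reflexive (ℚₚ.+-comm w U))
      (ℚₚ.≤-trans U+w≤m+y
      (ℚₚ.≤-trans (ℚₚ.+-mono-≤ m≤B y≤A) (ℚₚ.≤-reflexive (ℚₚ.+-comm B A)))))
      where
      ≉0 : ∀ {y} → y ≈ 1# → ¬ y ≈ 0#
      ≉0 y≈1 y≈0 = 1≉0 (trans (sym y≈1) y≈0)
      a₀≈1 = normalized-quotient d a f d₀≈1 f₀≈1 f≋ad
      b₀≈1 = normalized-quotient d b g d₀≈1 g₀≈1 g≋bd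
      r₀≈1 = normalized-quotient f r l f₀≈1 l₀≈1 (factor f l (proj₁ l∈))
      leadD = lead-of d x {0} (≉0 d₀≈1)
      w = proj₁ (proj₂ leadD)
      Ld = proj₂ (proj₂ (proj₂ leadD))
      leadA = lead-of a w {0} (≉0 a₀≈1)
      y = proj₁ (proj₂ leadA)
      La = proj₂ (proj₂ (proj₂ leadA))
      leadB = lead-of b w {0} (≉0 b₀≈1)
      K = proj₁ leadB
      m = proj₁ (proj₂ leadB)
      Lb = proj₂ (proj₂ (proj₂ leadB))
      leadR = lead-of r y {0} (≉0 r₀≈1)
      U = proj₁ (proj₂ leadR)
      Lr = proj₂ (proj₂ (proj₂ leadR))
      m≡ : m ≡ line (val Lb) K w
      m≡ = ≡.trans (≡.sym (V≡ Lb)) (line≡ (val Lb) K w)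
      y≤A : y ℚ.≤ A
      y≤A = hf y λ n → bd-cong (sym (f≋ad n)) (bound-⋆ {coeff a} {coeff d} (bound La) (bound Ld) n)
      m≤B : m ℚ.≤ B
      m≤B = hg m λ n → bd-cong (sym (g≋bd n)) (bound-⋆ {coeff b} {coeff d} (bound Lb) (bound Ld) n)
      L≤U : L ℚ.≤ U
      L≤U = bound≤lead (proj₂ (lead-product (proj₂ (lead-product Lr La)) Ld)) λ n → bd-cong (l≋rad n) (hl n)
      U+w≤m+y : U ℚ.+ w ℚ.≤ m ℚ.+ y
      U+w≤m+y = ≡.subst (λ t → U ℚ.+ w ℚ.≤ t ℚ.+ y) (≡.sym m≡)
        (descent coprime (≉0 a₀≈1) b₀≈1 r₀≈1 K K ℕₚ.≤-refl (ν-K Lb)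
          (≡.subst (Bound (coeff b) w) m≡ (bound Lb)) La (bound Lr))

    V-inequality : ∀ z → V v d z +ℝ∞ V v l z ≤ℝ∞ V v f z +ℝ∞ V v g z
    V-inequality z = compare (value z d d₀≈1) (value z l l₀≈1) (value z f f₀≈1) (value z g g₀≈1)
      where
      compare : Value z d → Value z l → Value z f → Value z g → V v d z +ℝ∞ V v l z ≤ℝ∞ V v f z +ℝ∞ V v g z
      compare (D , d≡ , hd , _) (L , l≡ , hl , _) (A , f≡ , _ , hf) (B , g≡ , _ , hg) =
        ≡.subst₂ _≤ℝ∞_ (≡.cong₂ _+ℝ∞_ (≡.sym d≡) (≡.sym l≡)) (≡.cong₂ _+ℝ∞_ (≡.sym f≡) (≡.sym g≡))
          -- The inequality holds exactly at every term, so the threshold is 0 and ε is pure slack.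
          [ (λ ε 0<ε → 0 , λ n _ → ℚₚ.≤-trans (norm-inequality (seq z n) (hd n) (hl n) (hf n) (hg n))
              (≤-from-0≤ ε (ℚₚ.<⇒≤ 0<ε) ≡.refl)) ]

theorem3p3 : ∀ {c ℓ a b} (q : ℕ) (F : Field c ℓ) → Contains𝔽 q F a b →
    (ν : DiscreteValuation F) → let open Twisted q F in
    (f g : Poly) → IsNormalized f → IsNormalized g →
    (d l : Poly) → IsNormalizedGCD f g d → IsNormalizedLCM f g l →
    (z : ℝ) → V ν d z +ℝ∞ V ν l z ≤ℝ∞ V ν f z +ℝ∞ V ν g z
theorem3p3 q F F⊇𝔽 ν f g f₀≈1 g₀≈1 d l gcd lcm =
  NewtonPolygon.V-inequality q (1<order F⊇𝔽) F (frobenius-+ F⊇𝔽) ν {f} {g} {d} {l} f₀≈1 g₀≈1 gcd lcm
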